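{- Let $G^*$ be an $n$-vertex connected class 1 $\Delta$-regular graph with $\Delta \geq \frac{2(n - 1)}{3}$. If $G$ is obtained from $G^*$ by a vertex-splitting, then $G$ is $\Delta$-critical.
   Context: All graphs are finite and simple. $\chi'(G)$ is the chromatic index and $\Delta(G)$ the maximum degree of $G$. A graph $G$ is class 1 if $\chi'(G)=\Delta(G)$, and class 2 if $\chi'(G)=\Delta(G)+1$. A graph $G$ is $\Delta$-critical if $\chi'(G)=\Delta(G)+1$ (with $\Delta(G)=\Delta$) and $\chi'(H)<\chi'(G)$ for every proper subgraph $H$ of $G$. A vertex-splitting in $G^*$ at a vertex $v$ gives a new graph $G$ obtained by replacing $v$ with two new adjacent vertices $v_1$ and $v_2$ and partitioning the neighborhood $N_{G^*}(v)$ into two nonempty subsets that, respectively, serve as the set of neighbors of $v_1$ and of $v_2$ from $V(G^*)$ in $G$. In this case $G$ is said to be obtained from $G^*$ by a vertex-splitting. -}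

module Defs where

open import Data.Bool using (Bool; true; false; T; _∨_; if_then_else_)
open import Data.Bool.Properties using (T?; ∨-zeroʳ)
open import Data.Fin using (Fin; zero; suc; toℕ; fromℕ<)
open import Data.Fin.Properties using (_≟_; toℕ<n; toℕ-injective; toℕ-fromℕ<; all?; any?)
open import Data.Fin.Subset using (Subset; ∣_∣; _∪_; _∩_; ⊥; Nonempty)
open import Data.List using (map; allFin)
open import Data.List.Extrema.Nat using (max)
open import Data.Nat using (ℕ; zero; suc; _+_; _≤_; _<_; z≤n; s≤s)
open import Data.Nat.Properties using (+-comm; +-cancelˡ-≡; +-mono-<)
open import Data.Product using (∃; ∃₂; _×_; _,_; proj₁; proj₂)
open import Data.Sum using (_⊎_)
open import Data.Vec using (Vec; []; _∷_; lookup; tabulate)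
open import Data.Vec.Properties using (lookup∘tabulate; lookup-zipWith)
open import Data.Empty using (⊥-elim)
open import Function using (_∘_)
open import Function.Bundles using (_↔_; Inverse)
open import Function.Definitions using (Injective)
open import Relation.Binary.Construct.Closure.ReflexiveTransitive using (Star)
open import Relation.Binary.PropositionalEquality
open import Relation.Nullary using (¬_; Dec; yes; no; does)
open import Relation.Nullary.Decidable using (map′; ¬?; _×-dec_; _→-dec_)

record Graph (n : ℕ) : Set where
  field
    adj        : Fin n → Fin n → Bool
    adj-sym    : ∀ u v → adj u v ≡ adj v u
    adj-irrefl : ∀ v → adj v v ≡ false

  Adj : Fin n → Fin n → Set
  Adj u v = T (adj u v)

  neighbourhood : Fin n → Subset n
  neighbourhood v = tabulate (adj v)

  degree : Fin n → ℕ
  degree v = ∣ neighbourhood v ∣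

  maxDegree : ℕ
  maxDegree = max 0 (map degree (allFin n))

open Graph public

Connected : ∀ {n} → Graph n → Set
Connected G = ∀ u v → Star (Adj G) u v

Regular : ∀ {n} → ℕ → Graph n → Set
Regular d G = ∀ v → degree G v ≡ d

-- The colour of an edge depends neither on its orientation nor on the proof
-- that it is an edge: `colour-sym` used twice gives the latter.
record EdgeColouring {n} (G : Graph n) (k : ℕ) : Set where
  field
    colour     : ∀ u v → Adj G u v → Fin k
    colour-sym : ∀ u v (e : Adj G u v) (e′ : Adj G v u) →
                 colour u v e ≡ colour v u e′
    proper     : ∀ u v w (e : Adj G u v) (e′ : Adj G u w) → v ≢ w →
                 colour u v e ≢ colour u w e′

open EdgeColouring public

IsChromaticIndex : ∀ {n} → Graph n → ℕ → Set
IsChromaticIndex G k = EdgeColouring G k × (∀ j → EdgeColouring G j → k ≤ j)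

private
  least : ∀ {P : ℕ → Set} → (∀ k → Dec (P k)) → ∀ K → P K →
          ∃ λ k → P k × (∀ j → P j → k ≤ j)
  least P? K p with P? 0
  least P? K p | yes p₀ = 0 , p₀ , λ _ _ → z≤n
  least P? zero p | no ¬p₀ = ⊥-elim (¬p₀ p)
  least P? (suc K) p | no ¬p₀ with least (P? ∘ suc) K p
  ... | k , q , min = suc k , q , λ where
    zero    p₀ → ⊥-elim (¬p₀ p₀)
    (suc j) pⱼ → s≤s (min j pⱼ)

  Searchable : Set → Set₁
  Searchable A = ∀ {P : A → Set} → (∀ a → Dec (P a)) → Dec (∃ P)

  search-Vec : ∀ {A} → Searchable A → ∀ n → Searchable (Vec A n)
  search-Vec s zero    P? = map′ ([] ,_) (λ where ([] , p) → p) (P? [])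
  search-Vec s (suc n) P? =
    map′ (λ where (x , xs , p) → x ∷ xs , p)
         (λ where (x ∷ xs , p) → x , xs , p)
         (s (λ x → search-Vec s n (λ xs → P? (x ∷ xs))))

  module _ {n} (G : Graph n) where

    Adj? : ∀ u v → Dec (Adj G u v)
    Adj? u v = T? (adj G u v)

    Good : ∀ {k} → Vec (Vec (Fin k) n) n → Set
    Good t = (∀ u v → Adj G u v → t ! u , v ≡ t ! v , u)
           × (∀ u v w → Adj G u v → Adj G u w → v ≢ w →
                t ! u , v ≢ t ! u , w)
      where
      infix 10 _!_,_
      _!_,_ : ∀ {A : Set} → Vec (Vec A n) n → Fin n → Fin n → A
      t ! u , v = lookup (lookup t u) v

    Good? : ∀ {k} (t : Vec (Vec (Fin k) n) n) → Dec (Good t)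
    Good? t =
      (all? λ u → all? λ v → Adj? u v →-dec (_ ≟ _))
      ×-dec
      (all? λ u → all? λ v → all? λ w →
        Adj? u v →-dec (Adj? u w →-dec (¬? (v ≟ w) →-dec ¬? (_ ≟ _))))

    fromTable : ∀ {k} → ∃ (Good {k}) → EdgeColouring G k
    fromTable (t , s , p) = record
      { colour     = λ u v _ → lookup (lookup t u) v
      ; colour-sym = λ u v e _ → s u v e
      ; proper     = p
      }

    toTable : ∀ {k} → EdgeColouring G (suc k) → ∃ (Good {suc k})
    toTable {k} c = t , sym′ , prop′
      where
      pick : ∀ u v → Dec (Adj G u v) → Fin (suc k)
      pick u v (yes e) = colour c u v e
      pick u v (no _)  = zero

      pick-yes : ∀ u v (d : Dec (Adj G u v)) (e : Adj G u v) →
                 pick u v d ≡ colour c u v e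
      pick-yes u v (yes e′) e =
        trans (colour-sym c u v e′ ē) (sym (colour-sym c u v e ē))
        where ē = subst T (adj-sym G u v) e
      pick-yes u v (no ¬e) e = ⊥-elim (¬e e)

      t : Vec (Vec (Fin (suc k)) n) n
      t = tabulate λ u → tabulate λ v → pick u v (Adj? u v)

      look : ∀ u v (e : Adj G u v) → lookup (lookup t u) v ≡ colour c u v e
      look u v e = trans
        (trans (cong (λ r → lookup r v) (lookup∘tabulate _ u))
               (lookup∘tabulate _ v))
        (pick-yes u v (Adj? u v) e)

      sym′ : ∀ u v → Adj G u v → lookup (lookup t u) v ≡ lookup (lookup t v) u
      sym′ u v e =
        trans (look u v e) (trans (colour-sym c u v e ē) (sym (look v u ē)))
        where ē = subst T (adj-sym G u v) e

      prop′ : ∀ u v w → Adj G u v → Adj G u w → v ≢ w →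
              lookup (lookup t u) v ≢ lookup (lookup t u) w
      prop′ u v w e e′ v≢w eq = proper c u v w e e′ v≢w
        (trans (sym (look u v e)) (trans eq (look u w e′)))

    edgeColouring? : ∀ k → Dec (EdgeColouring G k)
    edgeColouring? zero =
      map′ (λ ¬e → record
              { colour     = λ u v e → ⊥-elim (¬e u v e)
              ; colour-sym = λ u v e _ → ⊥-elim (¬e u v e)
              ; proper     = λ u v _ e _ _ → ⊥-elim (¬e u v e)
              })
           (λ c u v e → ¬Fin0 (colour c u v e))
           (all? λ u → all? λ v → ¬? (Adj? u v))
      where
      ¬Fin0 : ¬ Fin 0
      ¬Fin0 ()
    edgeColouring? (suc k) =
      map′ fromTable toTable (search-Vec (search-Vec any? n) n Good?)

    -- Colour the edge uv by u + v.
    trivialColouring : EdgeColouring G (n + n)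
    trivialColouring = record
      { colour     = λ u v _ → fromℕ< (bound u v)
      ; colour-sym = λ u v _ _ → toℕ-injective (trans (val u v)
          (trans (+-comm (toℕ u) (toℕ v)) (sym (val v u))))
      ; proper     = λ u v w _ _ v≢w eq → v≢w (toℕ-injective
          (+-cancelˡ-≡ (toℕ u) (toℕ v) (toℕ w)
            (trans (sym (val u v)) (trans (cong toℕ eq) (val u w)))))
      }
      where
      bound : ∀ (u v : Fin n) → toℕ u + toℕ v < n + n
      bound u v = +-mono-< (toℕ<n u) (toℕ<n v)

      val : ∀ u v → toℕ (fromℕ< (bound u v)) ≡ toℕ u + toℕ v
      val u v = toℕ-fromℕ< (bound u v)

chromaticIndex : ∀ {n} (G : Graph n) → ∃ (IsChromaticIndex G)
chromaticIndex {n} G = least (edgeColouring? G) (n + n) (trivialColouring G)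

χ′ : ∀ {n} → Graph n → ℕ
χ′ G = proj₁ (chromaticIndex G)

χ′-correct : ∀ {n} (G : Graph n) → IsChromaticIndex G (χ′ G)
χ′-correct G = proj₂ (chromaticIndex G)

Class1 : ∀ {n} → Graph n → Set
Class1 G = χ′ G ≡ maxDegree G

-- Subgraphs are taken up to relabelling of their vertices by `Fin m`, so H
-- comes with an embedding into G; it is proper when its image misses a vertex
-- or an edge of G.
record ProperSubgraph {m n} (H : Graph m) (G : Graph n) : Set where
  field
    embed     : Fin m → Fin n
    injective : Injective _≡_ _≡_ embed
    edges     : ∀ u v → Adj H u v → Adj G (embed u) (embed v)
    strict    : (∃ λ w → ∀ u → embed u ≢ w)
              ⊎ (∃₂ λ u v → Adj G (embed u) (embed v) × ¬ Adj H u v)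

Critical : ∀ {n} → ℕ → Graph n → Set
Critical Δ G = maxDegree G ≡ Δ
             × χ′ G ≡ suc (maxDegree G)
             × (∀ {m} (H : Graph m) → ProperSubgraph H G → χ′ H < χ′ G)

record _≅_ {m n} (G : Graph m) (H : Graph n) : Set where
  field
    vertices : Fin m ↔ Fin n
    adj-≡    : ∀ u v →
               adj G u v ≡ adj H (Inverse.to vertices u) (Inverse.to vertices v)

record Splitting {n} (G : Graph n) : Set where
  field
    v         : Fin n
    N₁ N₂     : Subset n
    covering  : N₁ ∪ N₂ ≡ neighbourhood G v
    disjoint  : N₁ ∩ N₂ ≡ ⊥
    nonempty₁ : Nonempty N₁
    nonempty₂ : Nonempty N₂

-- The vertex v₁ is `zero`, the vertex v₂ takes over the place `suc v` of v,
-- and every other vertex u of G becomes `suc u`.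
split : ∀ {n} (G : Graph n) → Splitting G → Graph (suc n)
split {n} G S = record { adj = a ; adj-sym = a-sym ; adj-irrefl = a-irrefl }
  where
  open Splitting S

  a : Fin (suc n) → Fin (suc n) → Bool
  a zero    zero    = false
  a zero    (suc w) = does (w ≟ v) ∨ lookup N₁ w
  a (suc u) zero    = does (u ≟ v) ∨ lookup N₁ u
  a (suc u) (suc w) = if does (u ≟ v) then lookup N₂ w
                      else if does (w ≟ v) then lookup N₂ u
                      else adj G u w

  a-sym : ∀ x y → a x y ≡ a y x
  a-sym zero    zero    = refl
  a-sym zero    (suc w) = refl
  a-sym (suc u) zero    = refl
  a-sym (suc u) (suc w) with u ≟ v | w ≟ v
  ... | yes refl | yes refl = refl
  ... | yes _    | no _     = refl
  ... | no _     | yes _    = refl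
  ... | no _     | no _     = adj-sym G u w

  v∉N₂ : lookup N₂ v ≡ false
  v∉N₂ with lookup N₂ v in eq
  ... | false = refl
  ... | true  = trans (sym v∈N) v∉N
    where
    v∈N : lookup (neighbourhood G v) v ≡ true
    v∈N = trans (cong (λ N → lookup N v) (sym covering))
         (trans (lookup-zipWith _∨_ v N₁ N₂)
         (trans (cong (lookup N₁ v ∨_) eq) (∨-zeroʳ (lookup N₁ v))))

    v∉N : lookup (neighbourhood G v) v ≡ false
    v∉N = trans (lookup∘tabulate (adj G v) v) (adj-irrefl G v)

  a-irrefl : ∀ x → a x x ≡ false
  a-irrefl zero    = refl
  a-irrefl (suc u) with u ≟ v
  ... | yes refl = v∉N₂
  ... | no _     = adj-irrefl G u

_ObtainedBySplitting_ : ∀ {m n} → Graph m → Graph n → Set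
G ObtainedBySplitting G* = ∃ λ (S : Splitting G*) → G ≅ split G* S

{-# OPTIONS --safe #-}
module Submission where

-- Let v be split into a and b. A Δ-edge-colouring of G* colours every edge of the split graph but ab
-- so that each colour is missing at exactly one of a and b and at no other vertex; G − xy is
-- Δ-colourable as soon as Kempe changes, starting from this colouring with xy uncoloured, end in one
-- that can be completed to ab. If xy meets {a, b} this is a single recolouring, and if x is adjacent
-- to b, it suffices to make the colour of xy one that is missing at b. Otherwise 3Δ ≥ 2(n − 1) yields
-- a common neighbour w of v, x and y, say on the side of b. Uncolour ab, bw, wx, wy, xy: the only
-- vertices at which colours are then missing are a, b, w, x, y, so for any two colours the two-coloured
-- paths pair up those of the five vertices that miss exactly one of them, and exchanging the colours
-- on a path is an operation on five lists of missing colours. Whatever the pairings are, a few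
-- rounds of exchanges make ab, bw, wx, wy colourable from these lists.
-- Conversely, Δ colours do not suffice for the split graph: the colour class of ab would be a perfect
-- matching on n + 1 vertices, whereas G* has one on n vertices.

open import Defs
open import Data.Bool using (Bool; true; false; T; _∧_; _∨_; _xor_; not; if_then_else_)
open import Data.Bool.Properties using (T?; T-≡; T-∧; T-∨; T-irrelevant; not-involutive; xor-comm)
open import Data.Empty using (⊥; ⊥-elim)
open import Data.Fin using (Fin; zero; suc; toℕ; punchOut; inject≤) renaming (_<_ to _<ᶠ_)
open import Data.Fin.Patterns using (0F; 1F; 2F; 3F; 4F)
open import Data.Fin.Permutation.Components using (transpose)
open import Data.Fin.Properties
  using (_≟_; any?; <-cmp; pigeonhole; suc-injective; 0≢1+n; punchOut-injective; injective⇒≤)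
open import Data.Fin.Subset using (∣_∣)
open import Data.List using (List; []; _∷_; _++_; map; [_]; allFin)
open import Data.List.Extrema.Nat using (max≤v⁺; v≤max⁺)
open import Data.List.Membership.Propositional using (lose)
open import Data.List.Membership.Propositional.Properties using (∈-allFin)
open import Data.List.Relation.Unary.All using (universal)
open import Data.List.Relation.Unary.All.Properties using () renaming (map⁺ to All-map⁺)
open import Data.List.Relation.Unary.Any using (Any; here; there)
open import Data.List.Relation.Unary.Any.Properties using () renaming (map⁺ to Any-map⁺)
open import Data.Nat using (ℕ; zero; suc; _+_; _*_; _∸_; _≤_; _<_; z≤n; s≤s; _<?_)
open import Data.Nat.Induction using (<-rec)
open import Data.Nat.Properties
  using (+-suc; *-comm; +-mono-≤; m≤m+n; m≤n+m; m<m+n; n<1+n; n≮n; m∸n≤m; m<n⇒0<n∸m; m+[n∸m]≡n;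
         ∸-monoʳ-<; ≤-refl; ≤-reflexive; ≤-trans; ≤-antisym; ≤-<-trans; <⇒≤; ≰⇒>; anyUpTo?;
         +-0-commutativeMonoid; module ≤-Reasoning)
  renaming (<-cmp to <-cmpⁿ; suc-injective to suc-injectiveⁿ)
open import Algebra.Properties.CommutativeMonoid.Sum +-0-commutativeMonoid using (sum; ∑-distrib-+)
open import Data.Nat.Tactic.RingSolver using (solve-∀)
open import Data.Product using (∃; ∃₂; Σ; _×_; _,_; proj₁; proj₂)
open import Data.Sum as Sum using (_⊎_; inj₁; inj₂)
open import Data.Unit using (⊤; tt)
open import Data.Vec using (Vec; []; _∷_; lookup; tabulate)
open import Data.Vec.Properties using (lookup∘tabulate; lookup-zipWith; lookup-replicate;
    []=⇒lookup)
open import Data.Vec.Relation.Unary.All using ([]; _∷_)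
open import Data.Vec.Relation.Unary.AllPairs using ([]; _∷_)
open import Data.Vec.Relation.Unary.Unique.Propositional using (Unique)
open import Data.Vec.Relation.Unary.Unique.Propositional.Properties using (lookup-injective)
open import Function using (_∘_; id)
open import Function.Bundles using (Equivalence; Inverse)
open import Function.Definitions using (Injective)
open import Relation.Binary.Definitions using (Tri; tri<; tri≈; tri>)
open import Relation.Binary.PropositionalEquality
  using (_≡_; _≢_; refl; sym; trans; cong; cong₂; subst; subst₂; ≢-sym; module ≡-Reasoning)
open import Relation.Nullary using (¬_; Dec; yes; no; does; contradiction)
open import Relation.Nullary.Decidable
  using (_×-dec_; map′; dec-true; dec-false; False; toWitnessFalse)

-- Kempe paths

Involutive : ∀ {m} → (Fin m → Fin m) → Set
Involutive f = ∀ u → f (f u) ≡ u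

transpose-matchˡ : ∀ {n} (i j : Fin n) → transpose i j i ≡ j
transpose-matchˡ i j rewrite dec-true (i ≟ i) refl = refl

transpose-matchʳ : ∀ {n} (i j : Fin n) → transpose i j j ≡ i
transpose-matchʳ i j with j ≟ i
... | yes refl = refl
... | no _ rewrite dec-true (j ≟ j) refl = refl

transpose-other : ∀ {n} {i j k : Fin n} → k ≢ i → k ≢ j → transpose i j k ≡ k
transpose-other {i = i} {j} {k} k≢i k≢j
  rewrite dec-false (k ≟ i) k≢i | dec-false (k ≟ j) k≢j = refl

transpose-involutive : ∀ {n} (i j : Fin n) → Involutive (transpose i j)
transpose-involutive i j k with k ≟ i
... | yes refl = transpose-matchʳ i j
... | no k≢i with k ≟ j
...   | yes refl = transpose-matchˡ i j
...   | no k≢j = transpose-other k≢i k≢j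

transpose-comm : ∀ {n} (i j k : Fin n) → transpose i j k ≡ transpose j i k
transpose-comm i j k = cases (k ≟ i) (k ≟ j)
  where
  cases : Dec (k ≡ i) → Dec (k ≡ j) → transpose i j k ≡ transpose j i k
  cases (yes refl) _          = trans (transpose-matchˡ i j) (sym (transpose-matchʳ j i))
  cases (no _)     (yes refl) = trans (transpose-matchʳ i j) (sym (transpose-matchˡ j i))
  cases (no k≢i)   (no k≢j)   = trans (transpose-other k≢i k≢j) (sym (transpose-other k≢j k≢i))

double≢odd : ∀ k t → k + k ≢ t + suc t
double≢odd zero    zero    ()
double≢odd zero    (suc t) ()
double≢odd (suc k) zero    eq with trans (sym (+-suc k k)) (suc-injectiveⁿ eq)
... | ()
double≢odd (suc k) (suc t) eq = double≢odd k t
  (suc-injectiveⁿ (trans (sym (+-suc k k)) (trans (suc-injectiveⁿ eq) (+-suc t (suc t)))))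

double-injective : ∀ k t → k + k ≡ t + t → k ≡ t
double-injective zero    zero    _  = refl
double-injective (suc k) (suc t) eq = cong suc (double-injective k t
  (suc-injectiveⁿ (trans (sym (+-suc k k)) (trans (suc-injectiveⁿ eq) (+-suc t t)))))

halve : ∀ P → (∃ λ t → P ≡ t + t) ⊎ (∃ λ t → P ≡ t + suc t)
halve zero = inj₁ (0 , refl)
halve (suc P) with halve P
... | inj₁ (t , refl) = inj₂ (t , sym (+-suc t t))
... | inj₂ (t , refl) = inj₁ (suc t , refl)

-- Let x k = (f ∘ g)ᵏ u, of period P. Then f (x k) = x (P − k) and g (x k) = x (P − k − 1), so that
-- the orbit of u is closed under f and g and its second end lies at half the period.
module _ {m} (f g : Fin m → Fin m) (f² : Involutive f) (g² : Involutive g)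
         {u} (fu : f u ≡ u) (gu : g u ≢ u) where

  -- `S` is the component of `u` in the union of the two matchings, a path because `f` is missing at
  -- `u`. By `end-odd` its second end misses exactly one of them, and by `only` no inner vertex
  -- misses any.
  record Path : Set where
    field
      S       : Fin m → Bool
      f-closed : ∀ w → S (f w) ≡ S w
      g-closed : ∀ w → S (g w) ≡ S w
      start   : S u ≡ true
      end     : Fin m
      end∈    : S end ≡ true
      end≢    : end ≢ u
      end-odd : (f end ≡ end × g end ≢ end) ⊎ (f end ≢ end × g end ≡ end)
      only    : ∀ w → S w ≡ true → f w ≡ w ⊎ g w ≡ w → w ≡ u ⊎ w ≡ end

  private
    x : ℕ → Fin m
    x zero    = u
    x (suc k) = f (g (x k))

    fg-injective : ∀ {v w} → f (g v) ≡ f (g w) → v ≡ w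
    fg-injective {v} {w} eq = begin
      v     ≡⟨ g² v ⟨
      g (g v) ≡⟨ cong g (trans (sym (f² (g v))) (trans (cong f eq) (f² (g w)))) ⟩
      g (g w) ≡⟨ g² w ⟩
      w ∎
      where open ≡-Reasoning

    -- The composite of two involutions is injective, so two equal terms can be moved back together
    -- until one of them is `u`: any repetition yields a period.
    x-cancel : ∀ i d → x i ≡ x (i + d) → u ≡ x d
    x-cancel zero    d eq = eq
    x-cancel (suc i) d eq = x-cancel i d (fg-injective eq)

    x-cancel′ : ∀ {i j} → i < j → x i ≡ x j → x (j ∸ i) ≡ u
    x-cancel′ {i} {j} i<j eq =
      sym (x-cancel i (j ∸ i) (trans eq (cong x (sym (m+[n∸m]≡n (<⇒≤ i<j))))))

    Period Minimal : ℕ → Set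
    Period P = 0 < P × x P ≡ u
    Minimal P = Period P × (∀ {Q} → Q < P → ¬ Period Q)

    period? : ∀ P → Dec (Period P)
    period? P = (0 <? P) ×-dec (x P ≟ u)

    minimise : ∀ P → Period P → ∃ Minimal
    minimise = <-rec _ λ P rec p → case P rec p (anyUpTo? period? P)
      where
      case : ∀ P → (∀ {Q} → Q < P → Period Q → ∃ Minimal) → Period P →
          Dec (∃ λ Q → Q < P × Period Q) → ∃ Minimal
      case P rec p (yes (Q , Q<P , q)) = rec Q<P q
      case P rec p (no ¬q) = P , p , λ Q<P q → ¬q (_ , Q<P , q)

    somePeriod : ∃ Period
    somePeriod with pigeonhole (n<1+n m) (x ∘ toℕ)
    ... | i , j , i<j , eq = toℕ j ∸ toℕ i , m<n⇒0<n∸m i<j , x-cancel′ i<j eq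

    module _ (P : ℕ) (0<P : 0 < P) (xP : x P ≡ u) (min : ∀ {Q} → Q < P → ¬ Period Q) where

      x-injective : ∀ {i j} → i < P → j < P → x i ≡ x j → i ≡ j
      x-injective {i} {j} i<P j<P eq with <-cmpⁿ i j
      ... | tri< i<j _ _ = contradiction (m<n⇒0<n∸m i<j , x-cancel′ i<j eq)
          (min (≤-<-trans (m∸n≤m j i) j<P))
      ... | tri≈ _ i≡j _ = i≡j
      ... | tri> _ _ j<i = contradiction (m<n⇒0<n∸m j<i , x-cancel′ j<i (sym eq))
          (min (≤-<-trans (m∸n≤m i j) i<P))

      -- Conjugation by `f` turns `f ∘ g` into its inverse, and `f` fixes `x 0`, so `f` runs through
      -- the period backwards.
      f-reflects : ∀ k l → k + l ≡ P → f (x k) ≡ x l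
      f-reflects zero    l refl = trans fu (sym xP)
      f-reflects (suc k) l eq   = begin
        f (f (g (x k)))   ≡⟨ f² _ ⟩
        g (x k)           ≡⟨ cong g
            (trans (sym (f² (x k))) (cong f (f-reflects k (suc l) (trans (+-suc k l) eq)))) ⟩
        g (f (f (g (x l)))) ≡⟨ cong g (f² _) ⟩
        g (g (x l))       ≡⟨ g² (x l) ⟩
        x l ∎
        where open ≡-Reasoning

      g-reflects : ∀ k l → k + suc l ≡ P → g (x k) ≡ x l
      g-reflects k l eq = trans (sym (f² _)) (f-reflects (suc k) l (trans (sym (+-suc k l)) eq))

      OnPath : Fin m → Set
      OnPath w = ∃ λ k → k < P × x k ≡ w

      onPath? : ∀ w → Dec (OnPath w)
      onPath? w = anyUpTo? (λ k → x k ≟ w) P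

      f-onPath : ∀ {w} → OnPath w → OnPath (f w)
      f-onPath (zero  , _ , refl) = 0 , 0<P , sym fu
      f-onPath (suc k , k<P , refl) = P ∸ suc k , ∸-monoʳ-< {P} (s≤s z≤n) (<⇒≤ k<P) ,
          sym (f-reflects (suc k) _ (m+[n∸m]≡n (<⇒≤ k<P)))

      g-onPath : ∀ {w} → OnPath w → OnPath (g w)
      g-onPath (k , k<P , refl) = P ∸ suc k , ∸-monoʳ-< {P} (s≤s z≤n) k<P ,
        sym (g-reflects k _ (trans (+-suc k _) (m+[n∸m]≡n k<P)))

      does-closed : ∀ {h : Fin m → Fin m} → Involutive h → (∀ {w} → OnPath w → OnPath (h w)) →
               ∀ w → does (onPath? (h w)) ≡ does (onPath? w)
      does-closed {h} h² step w with onPath? w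
      ... | yes p = dec-true (onPath? (h w)) (step p)
      ... | no ¬p = dec-false (onPath? (h w)) (λ q → ¬p (subst OnPath (h² w) (step q)))

      ends : ∀ t → t < P → x t ≢ u →
             (f (x t) ≡ x t × g (x t) ≢ x t) ⊎ (f (x t) ≢ x t × g (x t) ≡ x t) →
             (∀ k → k < P → f (x k) ≡ x k ⊎ g (x k) ≡ x k → k ≡ 0 ⊎ k ≡ t) → Path
      ends t t<P t≢ odd only = record
        { S = does ∘ onPath?
        ; f-closed = does-closed f² f-onPath
        ; g-closed = does-closed g² g-onPath
        ; start = dec-true (onPath? u) (0 , 0<P , refl)
        ; end = x t
        ; end∈ = dec-true (onPath? (x t)) (t , t<P , refl)
        ; end≢ = t≢
        ; end-odd = odd
        ; only = λ w w∈ fixed → only′ w (onPath? w) w∈ fixed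
        }
        where
        only′ : ∀ w (d : Dec (OnPath w)) → does d ≡ true → f w ≡ w ⊎ g w ≡ w → w ≡ u ⊎ w ≡ x t
        only′ w (yes (k , k<P , refl)) _ fixed with only k k<P fixed
        ... | inj₁ refl = inj₁ refl
        ... | inj₂ refl = inj₂ refl

      -- Vertices of one period determine their indices, so a fixed point of a reflection has an
      -- index equal to its mirror image.
      f-fixed : ∀ {k} → k < P → f (x k) ≡ x k → k ≡ 0 ⊎ k + k ≡ P
      f-fixed {zero}  _   _  = inj₁ refl
      f-fixed {suc k} k<P eq = inj₂ (trans (cong (suc k +_) k≡l) (m+[n∸m]≡n (<⇒≤ k<P)))
        where
        k≡l : suc k ≡ P ∸ suc k
        k≡l = x-injective k<P (∸-monoʳ-< {P} (s≤s z≤n) (<⇒≤ k<P))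
                (trans (sym eq) (f-reflects (suc k) _ (m+[n∸m]≡n (<⇒≤ k<P))))

      g-fixed : ∀ {k} → k < P → g (x k) ≡ x k → k + suc k ≡ P
      g-fixed {k} k<P eq = trans (+-suc k k) (trans (cong (suc k +_) k≡l) (m+[n∸m]≡n k<P))
        where
        k≡l : k ≡ P ∸ suc k
        k≡l = x-injective k<P (∸-monoʳ-< {P} (s≤s z≤n) k<P)
                (trans (sym eq) (g-reflects k _ (trans (+-suc k _) (m+[n∸m]≡n k<P))))

      -- The parity of the period decides which matching is missing at the far end: period `t + t`
      -- puts a fixed point of `f` at `x t`, period `t + suc t` one of `g`. In each case parity
      -- excludes fixed points of the other matching, apart from `u`.
      path : Path
      path with halve P
      ... | inj₁ (zero , refl) = contradiction 0<P (n≮n 0)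
      ... | inj₁ (t@(suc _) , P≡) = ends t t<P
              (λ eq → contradiction (x-injective t<P 0<P eq) λ ())
              (inj₁ (f-reflects t t (sym P≡) , λ eq →
                  double≢odd t t (trans (sym P≡) (sym (g-fixed t<P eq)))))
              λ { k k<P (inj₁ eq) → Sum.map₂ (λ e → double-injective k t (trans e P≡))
                  (f-fixed k<P eq)
                ; k k<P (inj₂ eq) → contradiction (sym (trans (g-fixed k<P eq) P≡))
                    (double≢odd t k) }
        where
        t<P : t < P
        t<P = subst (t <_) (sym P≡) (m<m+n t (s≤s z≤n))
      ... | inj₂ (t , P≡) = ends t t<P
              -- Here `x t` is fixed by `g`, unlike `u`; in particular the period is not 1.
              (λ eq → gu (subst (λ w → g w ≡ w) eq gx))
              (inj₂ ((λ eq → Sum.[ (λ { refl → gu gx }) , (λ e → double≢odd t t (trans e P≡)) ]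
                  (f-fixed t<P eq)) , gx))
              λ { k k<P (inj₁ eq) →
                  inj₁ (Sum.[ id , (λ e → contradiction (trans e P≡) (double≢odd k t)) ]
                  (f-fixed k<P eq))
                ; k k<P (inj₂ eq) →
                    inj₂ (double-injective k t
                    (suc-injectiveⁿ
                    (trans (sym (+-suc k k)) (trans (g-fixed k<P eq) (trans P≡ (+-suc t t)))))) }
        where
        t<P : t < P
        t<P = subst (t <_) (sym P≡) (m<m+n t (s≤s z≤n))
        gx : g (x t) ≡ x t
        gx = g-reflects t t (sym P≡)

  kempePath : Path
  kempePath with somePeriod
  ... | P₀ , p₀ with minimise P₀ p₀
  ...   | P , (0<P , xP) , min = path P 0<P xP min

-- Partial colourings

-- M c u is the neighbour of u along colour c, or u itself if c is missing at u. Nothing is lost by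
-- allowing M c to match non-adjacent vertices or an edge to have several colours.
Family : ℕ → ℕ → Set
Family k m = Fin k → Fin m → Fin m

-- The same conditional transposition acts on colours in `switch` and on vertices in `relink`.
swapIf : ∀ {k} → Bool → Fin k → Fin k → Fin k → Fin k
swapIf b i j c = if b then transpose i j c else c

swapIf-involutive : ∀ {k} b (i j : Fin k) → Involutive (swapIf b i j)
swapIf-involutive true  i j = transpose-involutive i j
swapIf-involutive false i j _ = refl

swapIf-other : ∀ {k} b {i j c : Fin k} → c ≢ i → c ≢ j → swapIf b i j c ≡ c
swapIf-other true  = transpose-other
swapIf-other false _ _ = refl

swapIf-preserves : ∀ {k p} (P : Fin k → Set p) b {i j} → P i → P j → ∀ c → P c → P (swapIf b i j c)
swapIf-preserves P true {i} {j} pi pj c pc with c ≟ i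
... | yes refl = pj
... | no _ with c ≟ j
...   | yes refl = pi
...   | no _ = pc
swapIf-preserves P false _ _ _ pc = pc

swapIf-const : ∀ {k} {A : Set} (f : Fin k → A) b {i j} → f i ≡ f j → ∀ c → f (swapIf b i j c) ≡ f c
swapIf-const f true {i} {j} eq c with c ≟ i
... | yes refl = sym eq
... | no _ with c ≟ j
...   | yes refl = eq
...   | no _ = refl
swapIf-const f false _ _ = refl

swapIf-map : ∀ {k l} {f : Fin k → Fin l} → (∀ {c d} → f c ≡ f d → c ≡ d) →
             ∀ b i j c → swapIf b (f i) (f j) (f c) ≡ f (swapIf b i j c)
swapIf-map inj false i j c = refl
swapIf-map {f = f} inj true i j c with c ≟ i
... | yes refl = transpose-matchˡ (f c) (f j)
... | no c≢i with c ≟ j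
...   | yes refl = transpose-matchʳ (f i) (f c)
...   | no c≢j = transpose-other (c≢i ∘ inj) (c≢j ∘ inj)

Closed : ∀ {m} → (Fin m → Bool) → (Fin m → Fin m) → Set
Closed S f = ∀ w → S (f w) ≡ S w

-- The Kempe exchange of `i` and `j` on `S`.
switch : ∀ {k m} → Fin k → Fin k → (Fin m → Bool) → Family k m → Family k m
switch i j S M d t = M (swapIf (S t) i j d) t

-- A step along `i` or `j` does not cross the boundary of `S`, so a vertex and its new partner
-- translate the colour in the same way; other colours are not affected.
switch-involutive : ∀ {k m} {M : Family k m} → (∀ c → Involutive (M c)) →
  ∀ {i j S} → Closed S (M i) → Closed S (M j) → ∀ c → Involutive (switch i j S M c)
switch-involutive {M = M} inv {i} {j} {S} Si Sj c t = begin
  M (swapIf (S (M c′ t)) i j c) (M c′ t) ≡⟨ cong (λ d → M d (M c′ t)) same ⟩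
  M c′ (M c′ t)                          ≡⟨ inv c′ t ⟩
  t ∎
  where
  open ≡-Reasoning
  c′ = swapIf (S t) i j c
  stays : S (M c t) ≡ S t → swapIf (S (M c′ t)) i j c ≡ c′
  stays pc = cong (λ b → swapIf b i j c)
    (swapIf-preserves (λ d → S (M d t) ≡ S t) (S t) (Si t) (Sj t) c pc)
  cases : Dec (c ≡ i) → Dec (c ≡ j) → swapIf (S (M c′ t)) i j c ≡ c′
  cases (yes refl) _          = stays (Si t)
  cases (no _)     (yes refl) = stays (Sj t)
  cases (no c≢i)   (no c≢j)   =
    trans (swapIf-other (S (M c′ t)) c≢i c≢j) (sym (swapIf-other (S t) c≢i c≢j))
  same = cases (c ≟ i) (c ≟ j)

-- Colours uv with c if c is missing at u and v, and uncolours uv if c is its colour.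
relink : ∀ {k m} → Fin k → Fin m → Fin m → Family k m → Family k m
relink c u v M d t = M d (swapIf (does (d ≟ c)) u v t)

relink-≡ : ∀ {k m} (M : Family k m) c u v t → relink c u v M c t ≡ M c (transpose u v t)
relink-≡ M c u v t rewrite dec-true (c ≟ c) refl = refl

relink-≢ : ∀ {k m} (M : Family k m) {c d} u v t → d ≢ c → relink c u v M d t ≡ M d t
relink-≢ M {c} {d} u v t d≢c rewrite dec-false (d ≟ c) d≢c = refl

relink-outside : ∀ {k m} (M : Family k m) {c u v t} → t ≢ u → t ≢ v → ∀ d →
    relink c u v M d t ≡ M d t
relink-outside M {c} t≢u t≢v d = cong (M d) (swapIf-other (does (d ≟ c)) t≢u t≢v)

-- In both cases `M c` maps the pair of `u` and `v` to itself, hence commutes with their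
-- transposition, and the product of commuting involutions is an involution.
relink-involutive : ∀ {k m} {M : Family k m} → (∀ c → Involutive (M c)) →
  ∀ {c u v} → (M c u ≡ u × M c v ≡ v) ⊎ M c u ≡ v → ∀ d → Involutive (relink c u v M d)
relink-involutive {M = M} inv {c} {u} {v} ok d t with d ≟ c
... | no _ = inv d t
... | yes refl = begin
  M c (transpose u v (M c (transpose u v t)))   ≡⟨ cong (M c) (commute (transpose u v t)) ⟩
  M c (M c (transpose u v (transpose u v t)))   ≡⟨ inv c _ ⟩
  transpose u v (transpose u v t)               ≡⟨ transpose-involutive u v t ⟩
  t ∎
  where
  open ≡-Reasoning
  M-injective : ∀ {s t} → M c s ≡ M c t → s ≡ t
  M-injective eq = trans (sym (inv c _)) (trans (cong (M c) eq) (inv c _))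
  commute′ : ∀ {u′ v′} → M c u ≡ u′ → M c v ≡ v′ → (∀ s → transpose u v s ≡ transpose u′ v′ s) →
             ∀ s → transpose u v (M c s) ≡ M c (transpose u v s)
  commute′ {u′} {v′} eu ev same s = trans (same (M c s))
      (trans (cong₂ (λ p q → transpose p q (M c s)) (sym eu) (sym ev))
      (swapIf-map M-injective true u v s))
  commute : ∀ s → transpose u v (M c s) ≡ M c (transpose u v s)
  commute = Sum.[ (λ (eu , ev) → commute′ eu ev (λ _ → refl))
                     , (λ e → commute′ e (trans (cong (M c) (sym e)) (inv c u))
                         (transpose-comm u v)) ] ok

module _ {m} (G : Graph m) where

  Edge : Set
  Edge = Fin m × Fin m

  Same : Edge → Edge → Set
  Same (u , v) (x , y) = (u ≡ x × v ≡ y) ⊎ (u ≡ y × v ≡ x)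

  Covers : ∀ {k} → Family k m → List Edge → Set
  Covers M R = ∀ u v → Adj G u v → (∃ λ c → M c u ≡ v) ⊎ Any (Same (u , v)) R

  record Colouring (k : ℕ) (R : List Edge) : Set where
    field
      M      : Family k m
      inv    : ∀ c → Involutive (M c)
      covers : Covers M R

  switch-covers : ∀ {k i j S R} {M : Family k m} → Covers M R → Covers (switch i j S M) R
  switch-covers {i = i} {j} {S} {M = M} cov u v e with cov u v e
  ... | inj₂ r = inj₂ r
  ... | inj₁ (c , eq) =
      inj₁ (swapIf (S u) i j c , trans (cong (λ d → M d u) (swapIf-involutive (S u) i j c)) eq)

  adj⇒≢ : ∀ {u v} → Adj G u v → u ≢ v
  adj⇒≢ e refl = subst T (adj-irrefl G _) e

  erase-covers : ∀ {k R c u v} {M : Family k m} → (∀ d → Involutive (M d)) → M c u ≡ v →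
                 Covers M R → Covers (relink c u v M) ((u , v) ∷ R)
  erase-covers {R = R} {c} {u} {v} {M} inv Mu≡v cov s t e with cov s t e
  ... | inj₂ r        = inj₂ (there r)
  ... | inj₁ (d , eq) = cases (d ≟ c) (s ≟ u) (s ≟ v)
    where
    cases : Dec (d ≡ c) → Dec (s ≡ u) → Dec (s ≡ v) →
            (∃ λ d → relink c u v M d s ≡ t) ⊎ Any (Same (s , t)) ((u , v) ∷ R)
    cases (no d≢c)   _          _          = inj₁ (d , trans (relink-≢ M u v s d≢c) eq)
    cases (yes refl) (yes refl) _          = inj₂ (here (inj₁ (refl , trans (sym eq) Mu≡v)))
    cases (yes refl) (no _)     (yes refl) =
      inj₂ (here (inj₂ (refl , trans (sym eq) (trans (cong (M c) (sym Mu≡v)) (inv c u)))))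
    cases (yes refl) (no s≢u)   (no s≢v)   = inj₁ (d , trans (relink-outside M s≢u s≢v d) eq)

  paint-covers : ∀ {k R c u v} {M : Family k m} → M c u ≡ u → M c v ≡ v →
                 Covers M ((u , v) ∷ R) → Covers (relink c u v M) R
  paint-covers {R = R} {c} {u} {v} {M} Mu Mv cov s t e with cov s t e
  ... | inj₂ (there r) = inj₂ r
  ... | inj₂ (here (inj₁ (refl , refl))) =
    inj₁ (c , trans (relink-≡ M c u v u) (trans (cong (M c) (transpose-matchˡ u v)) Mv))
  ... | inj₂ (here (inj₂ (refl , refl))) =
    inj₁ (c , trans (relink-≡ M c u v v) (trans (cong (M c) (transpose-matchʳ u v)) Mu))
  ... | inj₁ (d , eq) = inj₁ (d , cases (d ≟ c) (s ≟ u) (s ≟ v))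
    where
    cases : Dec (d ≡ c) → Dec (s ≡ u) → Dec (s ≡ v) → relink c u v M d s ≡ t
    cases (no d≢c)   _          _          = trans (relink-≢ M u v s d≢c) eq
    -- A colour missing at `u` would colour a loop there.
    cases (yes refl) (yes refl) _          = contradiction (trans (sym Mu) eq) (adj⇒≢ e)
    cases (yes refl) (no _)     (yes refl) = contradiction (trans (sym Mv) eq) (adj⇒≢ e)
    cases (yes refl) (no s≢u)   (no s≢v)   = trans (relink-outside M s≢u s≢v d) eq

-- Kempe exchanges as operations on tables of missing colours.

-- Which of K colours are missing at L vertices.
Table : ℕ → ℕ → Set
Table L K = Fin L → Fin K → Bool

pair : ∀ {L} → Fin L → Fin L → Fin L → Bool
pair u v t = does (t ≟ u) ∨ does (t ≟ v)

module _ {L K : ℕ} where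

  odd : Table L K → Fin K → Fin K → Fin L → Bool
  odd F i j u = F u i xor F u j

  toggle : Fin K → Fin K → (Fin L → Bool) → Table L K → Table L K
  toggle i j A F u c = F u (swapIf (A u) i j c)

  update : Bool → Fin K → Fin L → Fin L → Table L K → Table L K
  update b c u v F t d = if does (d ≟ c) ∧ pair u v t then b else F t d

  -- On concrete tables this evaluates to a product of unit types, so that `_` proves its instances.
  Paintable : Table L K → List (Fin L × Fin L) → List (Fin K) → Set
  Paintable F []             []       = ⊤
  Paintable F ((u , v) ∷ es) (c ∷ cs) =
    False (u ≟ v) × T (F u c) × T (F v c) × Paintable (update false c u v F) es cs
  Paintable F _              _        = ⊥

  toggle-agrees : ∀ (F : Table L K) {i j} u b b′ → (T (odd F i j u) → b ≡ b′) → ∀ c →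
      F u (swapIf b i j c) ≡ F u (swapIf b′ i j c)
  toggle-agrees F {i} {j} u b b′ same c with F u i in ei | F u j in ej
  ... | true  | false = cong (λ b → F u (swapIf b i j c)) (same tt)
  ... | false | true  = cong (λ b → F u (swapIf b i j c)) (same tt)
  ... | true  | true  = trans (swapIf-const (F u) b (trans ei (sym ej)) c)
      (sym (swapIf-const (F u) b′ (trans ei (sym ej)) c))
  ... | false | false = trans (swapIf-const (F u) b (trans ei (sym ej)) c)
      (sym (swapIf-const (F u) b′ (trans ei (sym ej)) c))

module Game {m k} (G : Graph m) {L K} (vs : Vec (Fin m) L) (vs! : Unique vs)
            (cs : Vec (Fin k) K) (cs! : Unique cs) where

  ℓ : Fin L → Fin m
  ℓ = lookup vs

  κ : Fin K → Fin k
  κ = lookup cs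

  ℓ-injective : ∀ {u v} → ℓ u ≡ ℓ v → u ≡ v
  ℓ-injective = lookup-injective vs! _ _

  κ-injective : ∀ {c d} → κ c ≡ κ d → c ≡ d
  κ-injective = lookup-injective cs! _ _

  locate : List (Fin L × Fin L) → List (Edge G)
  locate = map λ (u , v) → ℓ u , ℓ v

  -- By `full`, the ends of every path in two of the listed colours are listed vertices, so the
  -- table knows all candidates for an end.
  record Position (F : Table L K) (R : List (Fin L × Fin L)) : Set where
    field
      M      : Family k m
      inv    : ∀ c → Involutive (M c)
      covers : Covers G M (locate R)
      agrees : ∀ u c → does (M (κ c) (ℓ u) ≟ ℓ u) ≡ F u c
      full   : ∀ {t} → (∀ u → t ≢ ℓ u) → ∀ c → M (κ c) t ≢ t

    missing : ∀ {u c} → F u c ≡ true → M (κ c) (ℓ u) ≡ ℓ u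
    missing {u} {c} eq with M (κ c) (ℓ u) ≟ ℓ u | agrees u c
    ... | yes p | _ = p
    ... | no _ | e = contradiction (trans e eq) λ ()

    present : ∀ {u c} → F u c ≡ false → M (κ c) (ℓ u) ≢ ℓ u
    present {u} {c} eq p with agrees u c
    ... | e rewrite dec-true (M (κ c) (ℓ u) ≟ ℓ u) p = contradiction (trans e eq) λ ()

    recorded : ∀ {u c} → M (κ c) (ℓ u) ≡ ℓ u → F u c ≡ true
    recorded {u} {c} p = trans (sym (agrees u c)) (dec-true (_ ≟ _) p)

    unrecorded : ∀ {u c} → M (κ c) (ℓ u) ≢ ℓ u → F u c ≡ false
    unrecorded {u} {c} p = trans (sym (agrees u c)) (dec-false (_ ≟ _) p)

  -- S is a union of two-coloured components; A describes it only on the vertices of odd, since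
  -- exchanging i and j does not alter the table elsewhere.
  record Chain {F R} (P : Position F R) (i j : Fin K) (A : Fin L → Bool) : Set where
    open Position P
    field
      S        : Fin m → Bool
      i-closed : Closed S (M (κ i))
      j-closed : Closed S (M (κ j))
      on       : ∀ u → T (odd F i j u) → S (ℓ u) ≡ A u

  module _ {F R} (P : Position F R) where
    open Position P

    private
      walk : ∀ i j u₀ (Fi : F u₀ i ≡ true) (Fj : F u₀ j ≡ false) →
             Path (M (κ i)) (M (κ j)) (inv (κ i)) (inv (κ j)) (missing Fi) (present Fj) →
             ∃ λ u₁ → T (odd F i j u₁ ∧ not (does (u₁ ≟ u₀))) × Chain P i j (pair u₀ u₁)
      walk i j u₀ Fi Fj path = case (any? λ u → ℓ u ≟ end)
        where
        open Path path
        oddT : ∀ u → ℓ u ≡ end → T (odd F i j u)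
        oddT u e with subst (λ w → (M (κ i) w ≡ w × M (κ j) w ≢ w) ⊎
            (M (κ i) w ≢ w × M (κ j) w ≡ w)) (sym e) end-odd
        ... | inj₁ (p , q) = subst₂ (λ b b′ → T (b xor b′)) (sym (recorded p)) (sym (unrecorded q))
            tt
        ... | inj₂ (p , q) = subst₂ (λ b b′ → T (b xor b′)) (sym (unrecorded p)) (sym (recorded q))
            tt
        fixed : ∀ u → T (odd F i j u) → M (κ i) (ℓ u) ≡ ℓ u ⊎ M (κ j) (ℓ u) ≡ ℓ u
        fixed u o with F u i in ei | F u j in ej
        ... | true | _ = inj₁ (missing ei)
        ... | false | true = inj₂ (missing ej)
        case : Dec (∃ λ u → ℓ u ≡ end) → _
        -- An unlisted vertex misses neither colour and cannot be an end.
        case (no ¬u) with end-odd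
        ... | inj₁ (p , _) = contradiction p (full (λ u e → ¬u (u , sym e)) i)
        ... | inj₂ (_ , q) = contradiction q (full (λ u e → ¬u (u , sym e)) j)
        case (yes (u₁ , e)) = u₁ , Equivalence.from (T-∧ {odd F i j u₁} {not (does (u₁ ≟ u₀))})
            (oddT u₁ e ,
                subst (T ∘ not)
                (sym (dec-false (u₁ ≟ u₀) λ u₁≡u₀ → end≢ (trans (sym e) (cong ℓ u₁≡u₀)))) tt) ,
          record { S = S ; i-closed = f-closed ; j-closed = g-closed ; on = on }
          where
          on : ∀ u → T (odd F i j u) → S (ℓ u) ≡ pair u₀ u₁ u
          on u o with u ≟ u₀ | u ≟ u₁
          ... | yes refl | _ = start
          ... | no _ | yes refl = trans (cong S e) end∈
          ... | no u≢u₀ | no u≢u₁ with S (ℓ u) in eq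
          ...   | false = refl
          ...   | true with only (ℓ u) eq (fixed u o)
          ...     | inj₁ p = contradiction (ℓ-injective p) u≢u₀
          ...     | inj₂ p = contradiction (ℓ-injective (trans p (sym e))) u≢u₁

    -- The far end is not under control: a user has to split on `u₁`. On concrete tables the Boolean
    -- condition evaluates and removes `u₀` and the vertices that are not odd.
    query : ∀ i j u₀ → T (odd F i j u₀) →
            ∃ λ u₁ → T (odd F i j u₁ ∧ not (does (u₁ ≟ u₀))) × Chain P i j (pair u₀ u₁)
    query i j u₀ o with F u₀ i in ei | F u₀ j in ej
    ... | true | false = walk i j u₀ ei ej (kempePath _ _ _ _ _ _)
    ... | false | true with walk j i u₀ ej ei (kempePath _ _ _ _ _ _)
    ...   | u₁ , o₁ , ch = u₁ , subst (λ b → T (b ∧ not (does (u₁ ≟ u₀))))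
        (xor-comm (F u₁ j) (F u₁ i)) o₁ ,
            record { S = S ; i-closed = j-closed ; j-closed = i-closed
                   ; on = λ u o → on u (subst T (xor-comm (F u i) (F u j)) o) }
      where
      open Chain ch

    -- An exchange off a path differs from one on it by a global renaming of the two colours, but
    -- leaves the ends of the path as they were.
    complement : ∀ {i j A} → Chain P i j A → Chain P i j (not ∘ A)
    complement ch = record
      { S = not ∘ S
      ; i-closed = cong not ∘ i-closed
      ; j-closed = cong not ∘ j-closed
      ; on = λ u o → cong not (on u o) }
      where open Chain ch

    flip : ∀ {i j A} → Chain P i j A → Position (toggle i j A F) R
    flip {i} {j} {A} ch = record
      { M = switch (κ i) (κ j) S M
      ; inv = switch-involutive {M = M} inv {κ i} {κ j} {S} i-closed j-closed
      ; covers = switch-covers G {S = S} covers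
      ; agrees = λ u c →
          trans (cong (λ d → does (M d (ℓ u) ≟ ℓ u)) (swapIf-map κ-injective (S (ℓ u)) i j c))
                   (trans (agrees u (swapIf (S (ℓ u)) i j c)) (toggle-agrees F u (S (ℓ u)) (A u)
                       (on u) c))
      ; full = λ {t} t∉ c eq → full t∉ (swapIf (S t) i j c)
                 (trans (cong (λ d → M d t) (sym (swapIf-map κ-injective (S t) i j c))) eq)
      }
      where open Chain ch

    -- An exchange of two colours does not touch the matchings of two others, so a path found before
    -- it may be used after it.
    keep : ∀ {i j A} (ch : Chain P i j A) {i′ j′ A′} → Chain P i′ j′ A′ →
           i′ ≢ i → i′ ≢ j → j′ ≢ i → j′ ≢ j → Chain (flip ch) i′ j′ A′
    keep {i} {j} {A} ch {i′} {j′} ch′ p q r s = record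
      { S = S′
      ; i-closed = λ t →
          trans (cong (λ d → S′ (M d t)) (swapIf-other (S t) (p ∘ κ-injective) (q ∘ κ-injective)))
          (i-closed t)
      ; j-closed = λ t →
          trans (cong (λ d → S′ (M d t)) (swapIf-other (S t) (r ∘ κ-injective) (s ∘ κ-injective)))
          (j-closed t)
      ; on = λ u o →
          on u (subst T (cong₂ (λ c d → F u c xor F u d) (swapIf-other (A u) p q)
          (swapIf-other (A u) r s)) o)
      }
      where
      open Chain ch using (S)
      open Chain ch′ renaming (S to S′) using (i-closed; j-closed; on)

  module _ {F R} (P : Position F R) {u v : Fin L} {c : Fin K} where
    open Position P

    -- Erasing and painting are one operation; they differ in the hypothesis on `c` and in the bit
    -- written into the table.
    module Relink (ok : (M (κ c) (ℓ u) ≡ ℓ u × M (κ c) (ℓ v) ≡ ℓ v) ⊎ M (κ c) (ℓ u) ≡ ℓ v) where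
      M′ : Family k m
      M′ = relink (κ c) (ℓ u) (ℓ v) M

      inv′ : ∀ d → Involutive (M′ d)
      inv′ = relink-involutive {M = M} inv {κ c} {ℓ u} {ℓ v} ok

      full′ : ∀ {t} → (∀ u → t ≢ ℓ u) → ∀ d → M′ (κ d) t ≢ t
      full′ {t} t∉ d eq = full t∉ d (trans (sym (relink-outside M (t∉ u) (t∉ v) (κ d))) eq)

      agrees′ : ∀ b → does (M (κ c) (ℓ v) ≟ ℓ u) ≡ b → does (M (κ c) (ℓ u) ≟ ℓ v) ≡ b →
                ∀ t d → does (M′ (κ d) (ℓ t) ≟ ℓ t) ≡ update b c u v F t d
      agrees′ b eu ev t d with d ≟ c
      ... | no d≢c =
          trans (cong (λ s → does (s ≟ ℓ t)) (relink-≢ M (ℓ u) (ℓ v) (ℓ t) (d≢c ∘ κ-injective)))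
          (agrees t d)
      ... | yes refl with t ≟ u | t ≟ v
      ...   | yes refl | _ =
          trans (cong (λ s → does (s ≟ ℓ t)) (trans (relink-≡ M (κ c) (ℓ u) (ℓ v) (ℓ u))
          (cong (M (κ c)) (transpose-matchˡ (ℓ u) (ℓ v))))) eu
      ...   | no _ | yes refl =
          trans (cong (λ s → does (s ≟ ℓ t)) (trans (relink-≡ M (κ c) (ℓ u) (ℓ v) (ℓ v))
          (cong (M (κ c)) (transpose-matchʳ (ℓ u) (ℓ v))))) ev
      ...   | no t≢u | no t≢v =
          trans (cong (λ s → does (s ≟ ℓ t)) (relink-outside M (t≢u ∘ ℓ-injective)
          (t≢v ∘ ℓ-injective) (κ c))) (agrees t c)

    erase : M (κ c) (ℓ u) ≡ ℓ v → Position (update true c u v F) ((u , v) ∷ R)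
    erase eq = record
      { M = M′ ; inv = inv′ ; covers = erase-covers G inv eq covers
      ; agrees = agrees′ true (dec-true (_ ≟ _) (trans (cong (M (κ c)) (sym eq)) (inv (κ c) (ℓ u))))
          (dec-true (_ ≟ _) eq)
      ; full = full′ }
      where open Relink (inj₂ eq)

  paint : ∀ {F R} {u v : Fin L} → u ≢ v → (P : Position F ((u , v) ∷ R)) → ∀ c →
          F u c ≡ true → F v c ≡ true → Position (update false c u v F) R
  paint {u = u} {v} u≢v P c Fu Fv = record
    { M = M′ ; inv = inv′ ; covers = paint-covers G (missing Fu) (missing Fv) covers
    ; agrees = agrees′ false (dec-false (_ ≟ _) λ e →
        u≢v (ℓ-injective (trans (sym e) (missing Fv)) )) (dec-false (_ ≟ _) λ e →
        u≢v (ℓ-injective (trans (sym (missing Fu)) e)))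
    ; full = full′ }
    where
    open Position P
    open Relink P {u} {v} {c} (inj₁ (missing Fu , missing Fv))

  paintAll : ∀ {F e} es cs → Position F (es ++ [ e ]) → Paintable F es cs →
             Colouring G k (locate [ e ])
  paintAll []       []       P _ = record { M = M ; inv = inv ; covers = covers }
    where open Position P
  paintAll (_ ∷ es) (c ∷ cs) P (u≢v , Fu , Fv , rest) =
    paintAll es cs (paint (toWitnessFalse u≢v) P c (Equivalence.to T-≡ Fu) (Equivalence.to T-≡ Fv))
        rest

-- Edges xy of the split graph

module _ {m} (G : Graph m) where

  -- Each colour class misses a single vertex, either `a` or `b`. As an equation of Booleans,
  -- `exact` matches the first two rows of `initial`.
  record NearFactor (k : ℕ) (a b : Fin m) : Set where
    field
      M      : Family k m
      inv    : ∀ c → Involutive (M c)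
      covers : Covers G M [ (a , b) ]
      full   : ∀ {t} → t ≢ a → t ≢ b → ∀ c → M c t ≢ t
      exact  : ∀ c → does (M c a ≟ a) ≡ not (does (M c b ≟ b))

    at-a : ∀ {c} → M c b ≢ b → does (M c a ≟ a) ≡ true
    at-a {c} p = trans (exact c) (cong not (dec-false (_ ≟ _) p))

    not-at-a : ∀ {c} → M c b ≡ b → does (M c a ≟ a) ≡ false
    not-at-a {c} p = trans (exact c) (cong not (dec-true (_ ≟ _) p))

    adjacent : ∀ {u v} → Adj G u v → ¬ Same G (u , v) (a , b) → ∃ λ c → M c u ≡ v
    adjacent {u} {v} e ¬ab with covers u v e
    ... | inj₁ r = r
    ... | inj₂ (here s) = contradiction s ¬ab

  reverse : ∀ {k a b} → NearFactor k a b → NearFactor k b a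
  reverse S = record
    { M = M ; inv = inv ; full = λ p q → full q p
    ; covers = λ u v e → Sum.map₂ (λ { (here s) → here (Sum.swap s) }) (covers u v e)
    ; exact = λ c → trans (sym (not-involutive _)) (cong not (sym (exact c))) }
    where open NearFactor S

  Colouring-sym : ∀ {k x y} → Colouring G k [ (x , y) ] → Colouring G k [ (y , x) ]
  Colouring-sym C = record
    { M = M ; inv = inv
    ; covers = λ u v e → Sum.map₂ (λ { (here s) → here (Sum.swap s) }) (covers u v e) }
    where open Colouring C

  initial : ∀ {L K} → (Fin K → Bool) → Table (suc (suc L)) K
  initial α zero          c = α c
  initial α (suc zero)    c = not (α c)
  initial α (suc (suc _)) c = false

  module Start {k a b} (S : NearFactor k a b) {L K} (vs : Vec (Fin m) L) (vs! : Unique (a ∷ b ∷ vs))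
               (cs : Vec (Fin k) K) (cs! : Unique cs) where
    open NearFactor S
    open Game G (a ∷ b ∷ vs) vs! cs cs! public

    start : (α : Fin K → Bool) → (∀ c → does (M (κ c) a ≟ a) ≡ α c) →
        Position (initial α) [ (0F , 1F) ]
    start α eq = record
      { M = M ; inv = inv ; covers = covers
      ; agrees = λ where
          zero          c → eq c
          (suc zero)    c → trans (sym (not-involutive _))
              (cong not (trans (sym (exact (κ c))) (eq c)))
          (suc (suc u)) c → dec-false (_ ≟ _) (full
            (λ e → contradiction (ℓ-injective {suc (suc u)} {zero} e) λ ())
            (λ e → contradiction (ℓ-injective {suc (suc u)} {suc zero} e) λ ()) (κ c))
      ; full = λ t∉ c → full (t∉ zero) (t∉ (suc zero)) (κ c) }

    -- `paintAll` leaves the last edge of the list uncoloured; the reordering makes this the erased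
    -- edge instead of the edge from `a` to `b`.
    exchange : ∀ {F e e′} → Position F (e ∷ e′ ∷ []) → Position F (e′ ∷ e ∷ [])
    exchange P = record
      { M = P.M ; inv = P.inv ; agrees = P.agrees ; full = P.full
      ; covers = λ u v e → Sum.map₂ (λ { (here s) → there (here s) ; (there (here s)) → here s })
          (P.covers u v e) }
      where module P = Position P

  -- The colour of the edge from `a` to `y` is present at `a`, hence missing at `b`, so it can be
  -- moved to the edge from `a` to `b`.
  incident : ∀ {k a b y} → NearFactor k a b → Adj G a y → y ≢ b → a ≢ b → Colouring G k [ (a , y) ]
  incident {k} {a} {b} {y} S e y≢b a≢b with NearFactor.adjacent S e
      (λ { (inj₁ (_ , p)) → y≢b p ; (inj₂ (p , _)) → a≢b p })
  ... | j , Mja = paintAll [ (0F , 1F) ] [ 0F ] (exchange (erase P {0F} {2F} {0F} Mja)) _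
    where
    a≢y : a ≢ y
    a≢y = adj⇒≢ G e
    open Start S (y ∷ []) ((a≢b ∷ a≢y ∷ []) ∷ (≢-sym y≢b ∷ []) ∷ [] ∷ []) (j ∷ []) ([] ∷ [])
    P = start (λ _ → false) λ { 0F → dec-false (_ ≟ _) λ p → a≢y (trans (sym p) Mja) }

  module Far {k a b x y} (S : NearFactor k a b) (a≢b : a ≢ b) (xy : Adj G x y)
             (x≢a : x ≢ a) (x≢b : x ≢ b) (y≢a : y ≢ a) (y≢b : y ≢ b) where
    open NearFactor S

    private
      x≢y : x ≢ y
      x≢y = adj⇒≢ G xy

    Recoloured : Set
    Recoloured = Σ (NearFactor k a b) λ S′ →
        ∃ λ k → NearFactor.M S′ k x ≡ y × NearFactor.M S′ k b ≡ b

    -- Let the colour `j` of `xy` be present at `b`. With `xy` uncoloured, `a`, `x` and `y` miss `j`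
    -- but not `k`, and `b` misses `k` but not `j`. The end of the path from `a` decides between
    -- completing the colouring at once and changing the colour of `xy` to `k`.
    recolour : ∃ (λ k → M k b ≡ b) → Colouring G k [ (x , y) ] ⊎ Recoloured
    recolour (k , Mkb) with adjacent xy (λ { (inj₁ (p , _)) → x≢a p ; (inj₂ (p , _)) → x≢b p })
    ... | j , Mjx with M j b ≟ b
    ...   | yes Mjb = inj₂ (S , j , Mjx , Mjb)
    ...   | no Mjb = outcome (query P 0F 1F 0F tt)
      where
      j≢k : j ≢ k
      j≢k refl = Mjb Mkb
      open Start S (x ∷ y ∷ []) ((a≢b ∷ ≢-sym x≢a ∷ ≢-sym y≢a ∷ []) ∷ (≢-sym x≢b ∷ ≢-sym y≢b ∷ []) ∷
                                  (x≢y ∷ []) ∷ [] ∷ [])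
                   (j ∷ k ∷ []) ((j≢k ∷ []) ∷ [] ∷ [])
      P : Position (update true 0F 2F 3F (initial (lookup (true ∷ false ∷ []))))
          ((0F , 1F) ∷ (2F , 3F) ∷ [])
      P = exchange (erase (start _ λ { 0F → at-a Mjb ; 1F → not-at-a Mkb }) {2F} {3F} {0F} Mjx)
      outcome : _ → _
      outcome (0F , () , _)
      -- The path joins `a` and `b`. An exchange everywhere off it gives `xy` the colour `k` and
      -- changes nothing at `a` and `b`.
      outcome (1F , _ , ch) = inj₂ (S′ , k , M′kx , M′kb)
        where
        open Chain ch renaming (S to A)
        Aa : A a ≡ true
        Aa = on 0F tt
        Ab : A b ≡ true
        Ab = on 1F tt
        Ax : A x ≡ false
        Ax = on 2F tt
        Ay : A y ≡ false
        Ay = on 3F tt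
        Mjy : M j y ≡ x
        Mjy = trans (cong (M j) (sym Mjx)) (inv j x)
        k-closed′ : Closed A (M k)
        k-closed′ t = trans (cong A (sym (relink-≢ M x y t (≢-sym j≢k)))) (j-closed t)
        -- Putting `xy` back joins `x` to `y`, and both lie outside `A`.
        j-closed′ : Closed A (M j)
        j-closed′ t = cases (t ≟ x) (t ≟ y)
          where
          cases : Dec (t ≡ x) → Dec (t ≡ y) → A (M j t) ≡ A t
          cases (yes refl) _ = trans (cong A Mjx) (trans Ay (sym Ax))
          cases (no _) (yes refl) = trans (cong A Mjy) (trans Ax (sym Ay))
          cases (no t≢x) (no t≢y) = trans (cong A (sym (relink-outside M t≢x t≢y j))) (i-closed t)
        M′ = switch j k (not ∘ A) M
        same : ∀ {t} → A t ≡ true → ∀ c → M′ c t ≡ M c t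
        same {t} At c = cong (λ s → M (swapIf (not s) j k c) t) At
        S′ : NearFactor _ a b
        S′ = record
          { M = M′
          ; inv = switch-involutive {M = M} inv {j} {k} {not ∘ A} (cong not ∘ j-closed′)
              (cong not ∘ k-closed′)
          ; covers = switch-covers G {S = not ∘ A} covers
          ; full = λ p q c → full p q _
          ; exact = λ c → trans (cong (λ s → does (s ≟ a)) (same Aa c))
              (trans (exact c) (cong (λ s → not (does (s ≟ b))) (sym (same Ab c))))
          }
        M′kb : M′ k b ≡ b
        M′kb = trans (same Ab k) Mkb
        M′kx : M′ k x ≡ y
        M′kx = trans (cong (λ s → M (swapIf (not s) j k k) x) Ax)
            (trans (cong (λ c → M c x) (transpose-matchʳ j k)) Mjx)
      -- The exchange makes `k` missing at `a`, as it is at `b`.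
      outcome (2F , _ , ch) = inj₁ (paintAll [ (0F , 1F) ] [ 1F ] (flip P ch) _)
      outcome (3F , _ , ch) = inj₁ (paintAll [ (0F , 1F) ] [ 1F ] (flip P ch) _)

    -- The colour `k` of `xy` moves to `bx`, and the old colour `s` of `bx`, which is missing at
    -- `a`, moves to the edge from `a` to `b`.
    adjacent-end : ∀ {k} → M k x ≡ y → M k b ≡ b → Adj G b x → Colouring G _ [ (x , y) ]
    adjacent-end {k} Mkx Mkb bx with adjacent bx
        (λ { (inj₁ (p , _)) → a≢b (sym p) ; (inj₂ (_ , p)) → x≢a p })
    ... | s , Msb = paintAll ((1F , 2F) ∷ (0F , 1F) ∷ []) (0F ∷ 1F ∷ []) P _
      where
      k≢s : k ≢ s
      k≢s refl = x≢b (trans (sym Msb) Mkb)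
      open Start S (x ∷ y ∷ []) ((a≢b ∷ ≢-sym x≢a ∷ ≢-sym y≢a ∷ []) ∷ (≢-sym x≢b ∷ ≢-sym y≢b ∷ []) ∷
                                  (x≢y ∷ []) ∷ [] ∷ [])
                   (k ∷ s ∷ []) ((k≢s ∷ []) ∷ [] ∷ [])
      P₀ = start (lookup (false ∷ true ∷ []))
        λ { 0F → not-at-a Mkb ; 1F → at-a (λ p → x≢b (trans (sym Msb) p)) }
      P₁ = exchange (erase P₀ {2F} {3F} {0F} Mkx)
      P = erase P₁ {1F} {2F} {1F} (trans (relink-≢ M x y b (≢-sym k≢s)) Msb)

  -- The vertices 0, …, 4 are a, b, w, x, y and the colours 0, …, 3 those of xy, bw, wx, wy. The lists
  -- of colours below are for wy, wx, bw, ab, in this order; which colours to exchange was found by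
  -- exhaustive search.
  module Broom {k a b w x y} (S : NearFactor k a b) (a≢b : a ≢ b) (w≢a : w ≢ a)
               (xy : Adj G x y) (bw : Adj G b w) (wx : Adj G w x) (wy : Adj G w y)
               (x≢a : x ≢ a) (x≢b : x ≢ b) (y≢a : y ≢ a) (y≢b : y ≢ b)
               {r s p q : Fin k} (Mrx : NearFactor.M S r x ≡ y) (Mrb : NearFactor.M S r b ≡ b)
               (Msb : NearFactor.M S s b ≡ w) (Mpw : NearFactor.M S p w ≡ x)
               (Mqw : NearFactor.M S q w ≡ y) where
    open NearFactor S

    private
      w≢b : w ≢ b
      w≢b = ≢-sym (adj⇒≢ G bw)
      w≢x : w ≢ x
      w≢x = adj⇒≢ G wx
      w≢y : w ≢ y
      w≢y = adj⇒≢ G wy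
      x≢y : x ≢ y
      x≢y = adj⇒≢ G xy
      back : ∀ {c u v} → M c u ≡ v → M c v ≡ u
      back {c} {u} refl = inv c u
      r≢s : r ≢ s
      r≢s refl = w≢b (trans (sym Msb) Mrb)
      r≢p : r ≢ p
      r≢p refl = w≢y (trans (sym (back Mpw)) Mrx)
      r≢q : r ≢ q
      r≢q refl = w≢x (trans (sym (back Mqw)) (back Mrx))
      s≢p : s ≢ p
      s≢p refl = x≢b (trans (sym Mpw) (back Msb))
      s≢q : s ≢ q
      s≢q refl = y≢b (trans (sym Mqw) (back Msb))
      p≢q : p ≢ q
      p≢q refl = x≢y (trans (sym Mpw) Mqw)

    open Start S (w ∷ x ∷ y ∷ [])
      ((a≢b ∷ ≢-sym w≢a ∷ ≢-sym x≢a ∷ ≢-sym y≢a ∷ []) ∷ (≢-sym w≢b ∷ ≢-sym x≢b ∷ ≢-sym y≢b ∷ []) ∷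
       (w≢x ∷ w≢y ∷ []) ∷ (x≢y ∷ []) ∷ [] ∷ [])
      (r ∷ s ∷ p ∷ q ∷ []) ((r≢s ∷ r≢p ∷ r≢q ∷ []) ∷ (s≢p ∷ s≢q ∷ []) ∷ (p≢q ∷ []) ∷ [] ∷ [])

    edges : List (Fin 5 × Fin 5)
    edges = (2F , 4F) ∷ (2F , 3F) ∷ (1F , 2F) ∷ (0F , 1F) ∷ []

    -- Since `r` is missing at `b` and `s` is not, row `a` starts with `false` and `true`; `α` and
    -- `β` stand for `p` and `q`.
    broomTable : Bool → Bool → Table 5 4
    broomTable α β = update true 3F 2F 4F (update true 2F 2F 3F (update true 1F 1F 2F
                       (update true 0F 3F 4F (initial (lookup (false ∷ true ∷ α ∷ β ∷ []))))))

    Broken : Table 5 4 → Set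
    Broken F = Position F ((2F , 4F) ∷ (2F , 3F) ∷ (1F , 2F) ∷ (0F , 1F) ∷ (3F , 4F) ∷ [])

    broken : ∀ {α β} → does (M p a ≟ a) ≡ α → does (M q a ≟ a) ≡ β → Broken (broomTable α β)
    broken {α} {β} eα eβ = erase P₃ {2F} {4F} {3F}
        (trans (relink-≢ N₂ w x w (≢-sym p≢q)) (trans (relink-≢ N₁ b w w (≢-sym s≢q))
          (trans (relink-≢ M x y w (≢-sym r≢q)) Mqw)))
      where
      N₁ = relink r x y M
      N₂ = relink s b w N₁
      P₁ = exchange (erase (start (lookup (false ∷ true ∷ α ∷ β ∷ [])) λ where
             0F → not-at-a Mrb
             1F → at-a (λ e → w≢b (trans (sym Msb) e))
             2F → eα
             3F → eβ) {3F} {4F} {0F} Mrx)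
      P₂ = erase P₁ {1F} {2F} {1F} (trans (relink-≢ M x y b (≢-sym r≢s)) Msb)
      P₃ = erase P₂ {2F} {3F} {2F}
             (trans (relink-≢ N₁ b w w (≢-sym s≢p)) (trans (relink-≢ M x y w (≢-sym r≢p)) Mpw))

    done : ∀ {F} cs → Broken F → Paintable F edges cs → Colouring G k [ (x , y) ]
    done cs = paintAll edges cs

    -- Of `r` and `s`, `a` and `w` miss only `s`, `x` and `y` only `r`, and `b` misses both. The
    -- entry of `q` at `a` is left open, since `q` serves only for `wy`.
    missing-at-b : M p b ≡ b → Colouring G k [ (x , y) ]
    missing-at-b Mpb = outcome (query P 0F 1F 0F tt)
      where
      P = broken (not-at-a Mpb) refl
      outcome : _ → _
      outcome (0F , () , _)
      outcome (1F , () , _)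
      -- The exchange off the path turns `r` into `s` at `x`, so `wx` takes `s`, which frees `p` for
      -- `bw` and leaves `s` for the edge from `a` to `b`.
      outcome (2F , _ , ch) = done (3F ∷ 1F ∷ 2F ∷ 1F ∷ []) (flip P (complement P ch)) _
      -- Now `a` misses `r`, as `b` does: their edge takes `r`, and the edges at `w` get their old
      -- colours back.
      outcome (3F , _ , ch) = done (3F ∷ 2F ∷ 1F ∷ 0F ∷ []) (flip P ch) _
      outcome (4F , _ , ch) = done (3F ∷ 2F ∷ 1F ∷ 0F ∷ []) (flip P ch) _

    -- At first `s` is the only colour missing at both `a` and `b`, and also the only one missing at
    -- both `b` and `w`; the exchanges separate these two demands.
    missing-at-a : M p b ≢ b → M q b ≢ b → Colouring G k [ (x , y) ]
    missing-at-a Mpb Mqb = outcome (query P 0F 2F 0F tt)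
      where
      P : Broken (broomTable true true)
      P = broken (at-a Mpb) (at-a Mqb)

      module _ (ch : Chain P 0F 2F (pair 0F 1F)) where
        P₁ = flip P ch

        module _ (ch₁ : Chain P₁ 0F 1F (pair 1F 4F)) where
          P₂ = flip P₁ ch₁

          module _ (ch₂ : Chain P₁ 2F 3F (pair 0F 4F)) where
            P₃ = flip P₁ ch₂
            -- Whatever the answer, the edge from `a` to `b` takes `p` and `bw` takes `s`; the
            -- exchange of `r` and `q` serves only `wx` and `wy`.
            outcome₃ : (∃ λ u → T _ × Chain P₃ 0F 3F (pair 0F u)) → _
            outcome₃ (0F , () , _)
            outcome₃ (1F , () , _)
            outcome₃ (2F , _ , ch₃) = done (2F ∷ 0F ∷ 1F ∷ 2F ∷ []) (flip P₃ ch₃) _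
            outcome₃ (3F , _ , ch₃) = done (2F ∷ 3F ∷ 1F ∷ 2F ∷ []) (flip P₃ ch₃) _
            outcome₃ (4F , _ , ch₃) = done (3F ∷ 2F ∷ 1F ∷ 2F ∷ []) (flip P₃ ch₃) _

          outcome₂ : _ → _
          outcome₂ (0F , () , _)
          outcome₂ (1F , _ , ch₂) = done (1F ∷ 2F ∷ 3F ∷ 0F ∷ [])
              (flip P₂ (keep P₁ ch₁ ch₂ (λ ()) (λ ()) (λ ()) (λ ()))) _
          outcome₂ (2F , () , _)
          outcome₂ (3F , _ , ch₂) = done (1F ∷ 3F ∷ 2F ∷ 0F ∷ [])
              (flip P₂ (keep P₁ ch₁ ch₂ (λ ()) (λ ()) (λ ()) (λ ()))) _
          -- The exchange along `ch₁` is given up here; only the one along `ch₂` is made.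
          outcome₂ (4F , _ , ch₂) = outcome₃ ch₂ (query (P₃ ch₂) 0F 3F 0F tt)

        outcome₁ : _ → _
        outcome₁ (0F , () , _)
        outcome₁ (1F , () , _)
        outcome₁ (2F , _ , ch₁) = done (3F ∷ 0F ∷ 2F ∷ 0F ∷ []) (flip P₁ ch₁) _
        outcome₁ (3F , _ , ch₁) = done (3F ∷ 1F ∷ 2F ∷ 0F ∷ []) (flip P₁ ch₁) _
        -- This query concerns the two other colours, so the exchange along `ch₁` can wait for its
        -- answer.
        outcome₁ (4F , _ , ch₁) = outcome₂ ch₁ (query P₁ 2F 3F 0F tt)

      outcome : _ → _
      outcome (0F , () , _)
      outcome (1F , _ , ch) = outcome₁ ch (query (P₁ ch) 0F 1F 1F tt)
      outcome (2F , _ , ch) = done (3F ∷ 0F ∷ 1F ∷ 0F ∷ []) (flip P ch) _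
      outcome (3F , () , _)
      outcome (4F , _ , ch) = done (3F ∷ 2F ∷ 1F ∷ 0F ∷ []) (flip P ch) _

  broom : ∀ {k a b w x y} (S : NearFactor k a b) → a ≢ b → w ≢ a →
          Adj G x y → Adj G b w → Adj G w x → Adj G w y → x ≢ a → x ≢ b → y ≢ a → y ≢ b →
          ∀ {r} → NearFactor.M S r x ≡ y → NearFactor.M S r b ≡ b → Colouring G k [ (x , y) ]
  broom {b = b} {w} {x} {y} S a≢b w≢a xy bw wx wy x≢a x≢b y≢a y≢b {r} Mrx Mrb
    with NearFactor.adjacent S bw (λ { (inj₁ (p , _)) → a≢b (sym p) ; (inj₂ (_ , p)) → w≢a p })
       | NearFactor.adjacent S wx (λ { (inj₁ (p , _)) → w≢a p ; (inj₂ (_ , p)) → x≢a p })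
       | NearFactor.adjacent S wy (λ { (inj₁ (p , _)) → w≢a p ; (inj₂ (_ , p)) → y≢a p })
  ... | s , Msb | p , Mpw | q , Mqw with NearFactor.M S p b ≟ b | NearFactor.M S q b ≟ b
  ...   | yes Mpb | _ =
    Broom.missing-at-b S a≢b w≢a xy bw wx wy x≢a x≢b y≢a y≢b Mrx Mrb Msb Mpw Mqw Mpb
  ...   | no _ | yes Mqb =
    -- Interchanging `x` and `y` interchanges `p` and `q`.
    Colouring-sym (Broom.missing-at-b S a≢b w≢a yx bw wy wx y≢a y≢b x≢a x≢b Mry Mrb Msb Mqw Mpw Mqb)
    where
    yx = subst T (adj-sym G x y) xy
    Mry = trans (cong (NearFactor.M S r) (sym Mrx)) (NearFactor.inv S r x)
  ...   | no Mpb | no Mqb =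
    Broom.missing-at-a S a≢b w≢a xy bw wx wy x≢a x≢b y≢a y≢b Mrx Mrb Msb Mpw Mqw Mpb Mqb

  Free : ∀ {k a b} → NearFactor k a b → Fin m → Set
  Free S u = ∃ λ c → NearFactor.M S c u ≡ u

  near : ∀ {k a b x y} (S : NearFactor k a b) → a ≢ b → Free S a → Free S b →
         Adj G x y → x ≢ a → x ≢ b → y ≢ a → y ≢ b →
         Adj G a x ⊎ Adj G b x → Colouring G k [ (x , y) ]
  near S a≢b free-a free-b xy x≢a x≢b y≢a y≢b (inj₁ ax) =
    near (reverse S) (≢-sym a≢b) free-b free-a xy x≢b x≢a y≢b y≢a (inj₂ ax)
  near S a≢b free-a free-b xy x≢a x≢b y≢a y≢b (inj₂ bx)
    with Far.recolour S a≢b xy x≢a x≢b y≢a y≢b free-b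
  ... | inj₁ C = C
  ... | inj₂ (S′ , r , Mrx , Mrb) = Far.adjacent-end S′ a≢b xy x≢a x≢b y≢a y≢b Mrx Mrb bx

  far : ∀ {k a b x y} (S : NearFactor k a b) → a ≢ b → Free S a → Free S b →
        Adj G x y → x ≢ a → x ≢ b → y ≢ a → y ≢ b →
        ∀ {w} → w ≢ a → w ≢ b → Adj G w x → Adj G w y →
        Adj G a w ⊎ Adj G b w → Colouring G k [ (x , y) ]
  far S a≢b free-a free-b xy x≢a x≢b y≢a y≢b w≢a w≢b wx wy (inj₁ aw) =
    far (reverse S) (≢-sym a≢b) free-b free-a xy x≢b x≢a y≢b y≢a w≢b w≢a wx wy (inj₂ aw)
  far S a≢b free-a free-b xy x≢a x≢b y≢a y≢b w≢a w≢b wx wy (inj₂ bw)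
    with Far.recolour S a≢b xy x≢a x≢b y≢a y≢b free-b
  ... | inj₁ C = C
  ... | inj₂ (S′ , r , Mrx , Mrb) = broom S′ a≢b w≢a xy bw wx wy x≢a x≢b y≢a y≢b Mrx Mrb

-- Counting neighbours

-- Enumerates the subset in increasing order, which turns inequalities of degrees into injections
-- between sets `Fin`.
member : ∀ {n} (p : Fin n → Bool) → Fin ∣ tabulate p ∣ → Fin n
member {suc n} p i with p zero
member {suc n} p zero    | true  = zero
member {suc n} p (suc i) | true  = suc (member (p ∘ suc) i)
member {suc n} p i       | false = suc (member (p ∘ suc) i)

member∈ : ∀ {n} (p : Fin n → Bool) i → T (p (member p i))
member∈ {suc n} p i with p zero in eq
member∈ {suc n} p zero    | true  = Equivalence.from T-≡ eq
member∈ {suc n} p (suc i) | true  = member∈ (p ∘ suc) i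
member∈ {suc n} p i       | false = member∈ (p ∘ suc) i

member-injective : ∀ {n} (p : Fin n → Bool) {i j} → member p i ≡ member p j → i ≡ j
member-injective {suc n} p {i} {j} eq with p zero
member-injective {suc n} p {zero}  {zero}  eq | true  = refl
member-injective {suc n} p {suc i} {suc j} eq | true  =
    cong suc (member-injective (p ∘ suc) (suc-injective eq))
member-injective {suc n} p {i}     {j}     eq | false = member-injective (p ∘ suc)
    (suc-injective eq)

member-surjective : ∀ {n} (p : Fin n → Bool) u → T (p u) → ∃ λ i → member p i ≡ u
member-surjective {suc n} p u pu with p zero in eq
member-surjective {suc n} p zero    pu | true = zero , refl
member-surjective {suc n} p (suc u) pu | true with member-surjective (p ∘ suc) u pu
... | i , refl = suc i , refl
member-surjective {suc n} p zero    pu | false = ⊥-elim (subst T eq pu)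
member-surjective {suc n} p (suc u) pu | false with member-surjective (p ∘ suc) u pu
... | i , refl = i , refl

card-mono : ∀ {m n} (p : Fin m → Bool) (q : Fin n → Bool) (f : Fin m → Fin n) →
            (∀ {u} → T (p u) → T (q (f u))) →
            (∀ {u v} → T (p u) → T (p v) → f u ≡ f v → u ≡ v) →
            ∣ tabulate p ∣ ≤ ∣ tabulate q ∣
card-mono p q f preserves inj = injective⇒≤ {f = proj₁ ∘ h} λ {i} {j} eq →
  member-injective p (inj (member∈ p i) (member∈ p j)
    (trans (sym (proj₂ (h i))) (trans (cong (member q) eq) (proj₂ (h j)))))
  where
  h : ∀ i → ∃ λ j → member q j ≡ f (member p i)
  h i = member-surjective q _ (preserves (member∈ p i))

bit : Bool → ℕ
bit b = if b then 1 else 0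

card≡sum : ∀ {n} (p : Fin n → Bool) → ∣ tabulate p ∣ ≡ sum (bit ∘ p)
card≡sum {zero}  p = refl
card≡sum {suc n} p with p zero
... | true  = cong suc (card≡sum (p ∘ suc))
... | false = card≡sum (p ∘ suc)

sum-bound : ∀ {n} d {f : Fin n → ℕ} → (∀ u → f u ≤ d) → sum f ≤ n * d
sum-bound {zero}  d f≤d = z≤n
sum-bound {suc n} d f≤d = +-mono-≤ (f≤d zero) (sum-bound d (f≤d ∘ suc))

term≤sum : ∀ {n} (f : Fin n → ℕ) u → f u ≤ sum f
term≤sum f zero    = m≤m+n _ _
term≤sum f (suc u) = ≤-trans (term≤sum (f ∘ suc) u) (m≤n+m _ _)

-- Double counting: without a common neighbour every vertex is adjacent to at most two of `v`, `x`,
-- `y`, and the slack at `v` and `x` gives 3Δ ≤ 2n - 3 < 2(n - 1).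
commonNeighbour : ∀ {n Δ} (G : Graph n) → Regular Δ G → 2 * (n ∸ 1) ≤ 3 * Δ →
  ∀ {v x y} → ¬ Adj G v x → ¬ Adj G v y → v ≢ x → v ≢ y → Adj G x y →
  ∃ λ w → Adj G v w × Adj G x w × Adj G y w
commonNeighbour {suc n} {Δ} G reg bound {v} {x} {y} ¬vx ¬vy v≢x v≢y xy
  with any? (λ w → T? (adj G v w) ×-dec T? (adj G x w) ×-dec T? (adj G y w))
... | yes found = found
... | no none = contradiction tooMany (n≮n _)
  where
  δ : Fin (suc n) → Fin (suc n) → ℕ
  δ u w = bit (does (w ≟ u))
  deg : Fin (suc n) → Fin (suc n) → ℕ
  deg u w = bit (adj G u w)
  f g : Fin (suc n) → ℕ
  f w = (deg v w + deg x w) + deg y w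
  g w = (δ v w + δ v w) + δ x w

  -- v is adjacent to none of v, x, y, and x at most to y: this is the slack g.
  pointwise : ∀ w → f w + g w ≤ 2
  pointwise w with w ≟ v | w ≟ x
  pointwise w | yes refl | yes refl = contradiction refl v≢x
  pointwise w | yes refl | no _ 
    rewrite adj-irrefl G v | adj-sym G x v | adj-sym G y v with adj G v x | adj G v y
  ... | true | _ = ⊥-elim (¬vx tt)
  ... | false | true = ⊥-elim (¬vy tt)
  ... | false | false = ≤-refl
  pointwise w | no _ | yes refl rewrite adj-irrefl G x with adj G v x | adj G y x
  ... | true  | _     = ⊥-elim (¬vx tt)
  ... | false | true  = ≤-refl
  ... | false | false = s≤s z≤n
  pointwise w | no _ | no _ with adj G v w in ev | adj G x w in ex | adj G y w in ey
  ... | true | true | true =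
    ⊥-elim (none (w , Equivalence.from T-≡ ev , Equivalence.from T-≡ ex , Equivalence.from T-≡ ey))
  ... | true | true | false = ≤-refl
  ... | true | false | true = ≤-refl
  ... | true | false | false = s≤s z≤n
  ... | false | true | true = ≤-refl
  ... | false | true | false = s≤s z≤n
  ... | false | false | true = s≤s z≤n
  ... | false | false | false = z≤n

  sum-deg : ∀ u → sum (deg u) ≡ Δ
  sum-deg u = trans (sym (card≡sum (adj G u))) (reg u)

  sum-δ : ∀ u → 1 ≤ sum (δ u)
  sum-δ u = ≤-trans (≤-reflexive (sym (cong bit (dec-true (u ≟ u) refl)))) (term≤sum (δ u) u)

  3Δ : sum f ≡ (Δ + Δ) + Δ
  3Δ = trans (∑-distrib-+ (λ w → deg v w + deg x w) (deg y))
    (cong₂ _+_ (trans (∑-distrib-+ (deg v) (deg x)) (cong₂ _+_ (sum-deg v) (sum-deg x)))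
        (sum-deg y))

  3≤ : 3 ≤ sum g
  3≤ = ≤-trans (+-mono-≤ (+-mono-≤ (sum-δ v) (sum-δ v)) (sum-δ x))
    (≤-reflexive
        (sym (trans (∑-distrib-+ (λ w → δ v w + δ v w) (δ x))
        (cong (_+ sum (δ x)) (∑-distrib-+ (δ v) (δ v))))))

  tooMany : suc n * 2 < suc n * 2
  tooMany = begin-strict
    suc n * 2            ≡⟨ cong (2 +_) (*-comm n 2) ⟩
    -- The strict inequality unfolds to 3 + 2n ≤ 3 + 3Δ; the 3 is the lower bound for `sum g`.
    2 + 2 * n            <⟨ +-mono-≤ (≤-refl {3}) bound ⟩
    3 + 3 * Δ            ≡⟨ rearrange Δ ⟩
    (Δ + Δ) + Δ + 3      ≤⟨ +-mono-≤ (≤-reflexive (sym 3Δ)) 3≤ ⟩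
    sum f + sum g        ≡⟨ ∑-distrib-+ f g ⟨
    sum (λ w → f w + g w) ≤⟨ sum-bound 2 pointwise ⟩
    suc n * 2 ∎
    where
    open ≤-Reasoning
    rearrange : ∀ d → 3 + 3 * d ≡ (d + d) + d + 3
    rearrange = solve-∀

-- Colour classes

module _ {n k} {H : Graph n} (φ : EdgeColouring H k) where

  HasColour : Fin k → Fin n → Fin n → Set
  HasColour c u v = Σ (Adj H u v) λ e → EdgeColouring.colour φ u v e ≡ c

  hasColour? : ∀ c u v → Dec (HasColour c u v)
  hasColour? c u v with T? (adj H u v)
  ... | no ¬e = no (¬e ∘ proj₁)
  ... | yes e =
      map′ (e ,_) (λ (e′ , eq) → trans (cong (EdgeColouring.colour φ u v) (T-irrelevant e e′)) eq)
                     (EdgeColouring.colour φ u v e ≟ c)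

  hasColour-sym : ∀ {c u v} → HasColour c u v → HasColour c v u
  hasColour-sym {u = u} {v} (e , eq) = e′ , trans (sym (colour-sym φ u v e e′)) eq
    where e′ = subst T (adj-sym H u v) e

  hasColour-unique : ∀ {c u v w} → HasColour c u v → HasColour c u w → v ≡ w
  hasColour-unique {u = u} {v} {w} (e , eq) (e′ , eq′) with v ≟ w
  ... | yes v≡w = v≡w
  ... | no v≢w = contradiction (trans eq (sym eq′)) (proper φ u v w e e′ v≢w)

-- If `c` were missing at `u`, `punchOut` would inject the edges at `u` into `k − 1` colours.
saturated : ∀ {n k} {H : Graph n} (φ : EdgeColouring H k) {u} → k ≤ degree H u → ∀ c →
    ∃ (HasColour φ c u)
saturated {k = suc k} {H} φ {u} k≤ c with any? (hasColour? φ c u)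
... | yes found = found
... | no none = contradiction (≤-trans k≤ (injective⇒≤ {f = f} f-injective)) (n≮n _)
  where
  e : ∀ i → Adj H u (member (adj H u) i)
  e = member∈ (adj H u)
  c≢ : ∀ i → c ≢ EdgeColouring.colour φ u _ (e i)
  c≢ i eq = none (_ , e i , sym eq)
  f : Fin (degree H u) → Fin k
  f i = punchOut (c≢ i)
  f-injective : Injective _≡_ _≡_ f
  f-injective {i} {j} eq = member-injective (adj H u)
    (hasColour-unique φ (e i , punchOut-injective (c≢ i) (c≢ j) eq) (e j , refl))

-- A colour present at every vertex is a perfect matching, encoded as an involution without fixed
-- points.
module Partner {n k} {H : Graph n} (φ : EdgeColouring H k) {c}
    (sat : ∀ u → ∃ (HasColour φ c u)) where

  partner : Fin n → Fin n
  partner = proj₁ ∘ sat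

  partner-unique : ∀ {u v} → HasColour φ c u v → partner u ≡ v
  partner-unique = hasColour-unique φ (proj₂ (sat _))

  partner-involutive : Involutive partner
  partner-involutive u = partner-unique (hasColour-sym φ (proj₂ (sat u)))

  partner-≢ : ∀ u → partner u ≢ u
  partner-≢ u eq = adj⇒≢ H (proj₁ (proj₂ (sat u))) (sym eq)

extend : ∀ {n} → (Fin n → Fin n) → Fin (suc n) → Fin (suc n)
extend f zero    = zero
extend f (suc u) = suc (f u)

extend-involutive : ∀ {n} {f : Fin n → Fin n} → Involutive f → Involutive (extend f)
extend-involutive inv zero    = refl
extend-involutive inv (suc u) = cong suc (inv u)

-- The Kempe path from the additional vertex zero would have no second end.
no-consecutive-perfect-matchings : ∀ {n} {f : Fin n → Fin n} {g : Fin (suc n) → Fin (suc n)} →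
  Involutive f → (∀ u → f u ≢ u) → Involutive g → (∀ u → g u ≢ u) → ⊥
no-consecutive-perfect-matchings {f = f} {g} f² f≢ g² g≢
  with kempePath (extend f) g (extend-involutive f²) g² {zero} refl (g≢ zero)
... | record { end = end ; end-odd = inj₂ (_ , eq) } = g≢ end eq
... | record { end = zero ; end≢ = end≢ } = end≢ refl
... | record { end = suc u ; end-odd = inj₁ (eq , _) } = f≢ u (suc-injective eq)

-- Vertex splitting

module Split {n Δ} (G : Graph n) (φ : EdgeColouring G Δ) (reg : Regular Δ G) (S : Splitting G) where

  open Splitting S

  Gˢ : Graph (suc n)
  Gˢ = split G S

  a b : Fin (suc n)
  a = zero
  b = suc v

  a≢b : a ≢ b
  a≢b = 0≢1+n

  In₁ In₂ : Fin n → Set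
  In₁ w = T (lookup N₁ w)
  In₂ w = T (lookup N₂ w)

  either : ∀ w → lookup N₁ w ∨ lookup N₂ w ≡ adj G v w
  either w = trans (sym (lookup-zipWith _∨_ w N₁ N₂))
    (trans (cong (λ N → lookup N w) covering) (lookup∘tabulate (adj G v) w))

  adj⇒In : ∀ {w} → Adj G v w → In₁ w ⊎ In₂ w
  adj⇒In {w} e = Equivalence.to T-∨ (subst T (sym (either w)) e)

  In₁⇒adj : ∀ {w} → In₁ w → Adj G v w
  In₁⇒adj {w} p = subst T (either w) (Equivalence.from (T-∨ {lookup N₁ w}) (inj₁ p))

  In₂⇒adj : ∀ {w} → In₂ w → Adj G v w
  In₂⇒adj {w} p = subst T (either w) (Equivalence.from (T-∨ {lookup N₁ w}) (inj₂ p))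

  In₁⇒¬In₂ : ∀ {w} → In₁ w → ¬ In₂ w
  In₁⇒¬In₂ {w} p q = contradiction
    (trans (sym (cong₂ _∧_ (Equivalence.to T-≡ p) (Equivalence.to T-≡ q)))
      (trans (sym (lookup-zipWith _∧_ w N₁ N₂))
        (trans (cong (λ N → lookup N w) disjoint) (lookup-replicate w false)))) λ ()

  some₁ : ∃ In₁
  some₁ = proj₁ nonempty₁ , Equivalence.from T-≡ ([]=⇒lookup (proj₂ nonempty₁))

  some₂ : ∃ In₂
  some₂ = proj₁ nonempty₂ , Equivalence.from T-≡ ([]=⇒lookup (proj₂ nonempty₂))

  ab : Adj Gˢ a b
  ab = subst (λ d → T (d ∨ lookup N₁ v)) (sym (dec-true (v ≟ v) refl)) tt

  reverse-adj : ∀ {x y} → Adj Gˢ x y → Adj Gˢ y x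
  reverse-adj {x} {y} = subst T (adj-sym Gˢ x y)

  a-adj : ∀ {w} → In₁ w → Adj Gˢ a (suc w)
  a-adj {w} p = Equivalence.from (T-∨ {does (w ≟ v)}) (inj₂ p)

  b-adj : ∀ {w} → In₂ w → Adj Gˢ b (suc w)
  b-adj {w} p =
      subst (λ d → T (if d then lookup N₂ w else if does (w ≟ v) then lookup N₂ v else adj G v w))
      (sym (dec-true (v ≟ v) refl)) p

  other-adj : ∀ {u w} → u ≢ v → w ≢ v → Adj G u w → Adj Gˢ (suc u) (suc w)
  other-adj {u} {w} u≢v w≢v e
    rewrite dec-false (u ≟ v) u≢v | dec-false (w ≟ v) w≢v = e

  -- Adjacency in the split graph is a nested conditional; the constructors name its kinds of edges,
  -- and `view` finds one of them up to orientation.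
  data Edgeˢ : Fin (suc n) → Fin (suc n) → Set where
    a–b   : Edgeˢ a b
    a–N₁  : ∀ {w} → In₁ w → Edgeˢ a (suc w)
    b–N₂  : ∀ {w} → In₂ w → Edgeˢ b (suc w)
    other : ∀ {u w} → u ≢ v → w ≢ v → Adj G u w → Edgeˢ (suc u) (suc w)

  view : ∀ x y → Adj Gˢ x y → Edgeˢ x y ⊎ Edgeˢ y x
  view zero    (suc w) e with w ≟ v
  ... | yes refl = inj₁ a–b
  ... | no _ = inj₁ (a–N₁ e)
  view (suc u) zero    e with u ≟ v
  ... | yes refl = inj₂ a–b
  ... | no _ = inj₂ (a–N₁ e)
  view (suc u) (suc w) e with u ≟ v
  ... | yes refl = inj₁ (b–N₂ e)
  ... | no u≢v with w ≟ v
  ...   | yes refl = inj₂ (b–N₂ e)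
  ...   | no w≢v = inj₁ (other u≢v w≢v e)

  sat : ∀ c u → ∃ (HasColour φ c u)
  sat c u = saturated φ (≤-reflexive (sym (reg u))) c

  module P (c : Fin Δ) = Partner φ (sat c)
  open P using (partner)

  -- extend matches the edge of v coloured c to b; conjugating by (a b) moves it to a.
  lift : Bool → Fin Δ → Fin (suc n) → Fin (suc n)
  lift true  c x = transpose a b (extend (partner c) (transpose a b x))
  lift false c   = extend (partner c)

  at₁ : Fin Δ → Bool
  at₁ c = lookup N₁ (partner c v)

  M : Family Δ (suc n)
  M c = lift (at₁ c) c

  extend-inv : ∀ c → Involutive (extend (partner c))
  extend-inv c = extend-involutive (P.partner-involutive c)

  lift-inv : ∀ s c → Involutive (lift s c)
  lift-inv false c = extend-inv c
  lift-inv true  c x = begin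
    τ (ε (τ (τ (ε (τ x))))) ≡⟨ cong (τ ∘ ε) (transpose-involutive a b (ε (τ x))) ⟩
    τ (ε (ε (τ x)))         ≡⟨ cong τ (extend-inv c (τ x)) ⟩
    τ (τ x)                 ≡⟨ transpose-involutive a b x ⟩
    x ∎
    where
    open ≡-Reasoning
    τ = transpose a b
    ε = extend (partner c)

  inv : ∀ c → Involutive (M c)
  inv c = lift-inv (at₁ c) c

  ≢b : ∀ {u} → u ≢ v → suc u ≢ b
  ≢b u≢v = u≢v ∘ suc-injective

  fix : ∀ {u} → u ≢ v → transpose a b (suc u) ≡ suc u
  fix u≢v = transpose-other (≢-sym 0≢1+n) (≢b u≢v)

  partner-v≢ : ∀ c → partner c v ≢ v
  partner-v≢ c = P.partner-≢ c v

  lift-a : ∀ c → lift true c a ≡ suc (partner c v)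
  lift-a c = trans (cong (transpose a b ∘ extend (partner c)) (transpose-matchˡ a b))
      (fix (partner-v≢ c))

  lift-b : ∀ c → lift true c b ≡ b
  lift-b c = trans (cong (transpose a b ∘ extend (partner c)) (transpose-matchʳ a b))
      (transpose-matchˡ a b)

  lift-other : ∀ s c {u w} → u ≢ v → w ≢ v → partner c u ≡ w → lift s c (suc u) ≡ suc w
  lift-other false c _ _ eq = cong suc eq
  lift-other true c u≢v w≢v refl = trans (cong (transpose a b ∘ extend (partner c)) (fix u≢v))
      (fix w≢v)

  edge-colour : ∀ {x y} → Edgeˢ x y → (∃ λ c → M c x ≡ y) ⊎ x ≡ a × y ≡ b
  edge-colour a–b = inj₂ (refl , refl)
  edge-colour (a–N₁ {w} p) =
      inj₁ (c , trans (cong (λ s → lift s c a) s≡) (trans (lift-a c) (cong suc pc)))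
    where
    e = In₁⇒adj p
    c = EdgeColouring.colour φ v w e
    pc : partner c v ≡ w
    pc = P.partner-unique c (e , refl)
    s≡ : at₁ c ≡ true
    s≡ = trans (cong (lookup N₁) pc) (Equivalence.to T-≡ p)
  edge-colour (b–N₂ {w} p) = inj₁ (c , trans (cong (λ s → lift s c b) s≡) (cong suc pc))
    where
    e = In₂⇒adj p
    c = EdgeColouring.colour φ v w e
    pc : partner c v ≡ w
    pc = P.partner-unique c (e , refl)
    s≡ : at₁ c ≡ false
    s≡ with lookup N₁ (partner c v) in eq
    ... | false = refl
    ... | true  = contradiction p (In₁⇒¬In₂ (subst In₁ pc (Equivalence.from T-≡ eq)))
  edge-colour (other {u} {w} u≢v w≢v e) =
      inj₁ (c , lift-other (at₁ c) c u≢v w≢v (P.partner-unique c (e , refl)))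
    where c = EdgeColouring.colour φ u w e

  nearFactor : NearFactor Gˢ Δ a b
  nearFactor = record { M = M ; inv = inv ; covers = covers ; full = λ p q c → full (at₁ c) c p q ;
      exact = λ c → exact (at₁ c) c }
    where
    covers : Covers Gˢ M [ (a , b) ]
    covers x y e with view x y e
    ... | inj₁ p = Sum.map₂ (here ∘ inj₁) (edge-colour p)
    ... | inj₂ p = Sum.map (λ (c , eq) → c , trans (cong (M c) (sym eq)) (inv c y))
                                (λ (p , q) → here (inj₂ (q , p))) (edge-colour p)
    full : ∀ s c {t} → t ≢ a → t ≢ b → lift s c t ≢ t
    full s     c {zero}  t≢a _   eq = t≢a refl
    full false c {suc u} _   t≢b eq = P.partner-≢ c u (suc-injective eq)
    full true  c {suc u} _   t≢b eq = P.partner-≢ c u (suc-injective (begin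
      extend (partner c) (suc u)                    ≡⟨ cong (extend (partner c)) τu ⟨
      extend (partner c) (τ (suc u))                ≡⟨ transpose-involutive a b _ ⟨
      τ (τ (extend (partner c) (τ (suc u))))        ≡⟨ cong τ eq ⟩
      τ (suc u)                                     ≡⟨ τu ⟩
      suc u ∎))
      where
      open ≡-Reasoning
      τ = transpose a b
      τu : τ (suc u) ≡ suc u
      τu = fix (t≢b ∘ cong suc)
    exact : ∀ s c → does (lift s c a ≟ a) ≡ not (does (lift s c b ≟ b))
    exact true c = trans (dec-false (_ ≟ _) (λ eq → 0≢1+n (trans (sym eq) (lift-a c))))
                         (cong not (sym (dec-true (_ ≟ _) (lift-b c))))
    exact false c =
        cong not (sym (dec-false (suc (partner c v) ≟ b) (partner-v≢ c ∘ suc-injective)))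

  -- A colour that leads from `v` into `N₁` goes to `a` and becomes missing at `b`; `N₁` is
  -- nonempty.
  free-at-b : ∃ λ c → M c b ≡ b
  free-at-b with some₁
  ... | w , p = c ,
      trans (cong (λ s → lift s c b) (trans (cong (lookup N₁) (P.partner-unique c (e , refl)))
      (Equivalence.to T-≡ p))) (lift-b c)
    where
    e = In₁⇒adj p
    c = EdgeColouring.colour φ v w e

  free-at-a : ∃ λ c → M c a ≡ a
  free-at-a with some₂
  ... | w , p with edge-colour (b–N₂ p)
  ...   | inj₂ ()
  ...   | inj₁ (c , eq) with M c a ≟ a
  ...     | yes fixed = c , fixed
  -- A colour present at `a` would be missing at `b`, where this one colours an edge into `N₂`.
  ...     | no moved = contradiction (trans (sym eq) b-fixed)
      (λ w≡v → adj⇒≢ G (In₂⇒adj p) (sym (suc-injective w≡v)))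
    where
    b-fixed : M c b ≡ b
    b-fixed with M c b ≟ b | NearFactor.exact nearFactor c
    ... | yes q | _ = q
    ... | no _ | ex = contradiction (trans (sym (dec-false (M c a ≟ a) moved)) ex) λ ()

  -- Contraction of the new edge is injective on the neighbours, because no vertex lies in both `N₁`
  -- and `N₂`.
  other-degree≤ : ∀ {u} → u ≢ v → degree Gˢ (suc u) ≤ Δ
  other-degree≤ {u} u≢v = subst (_ ≤_) (reg u) (card-mono (adj Gˢ (suc u)) (adj G u) ψ
      (λ {y} → preserves {y}) (λ {y} {z} → inj {y} {z}))
    where
    ψ : Fin (suc n) → Fin n
    ψ zero    = v
    ψ (suc w) = w
    at-zero : Adj Gˢ (suc u) zero → In₁ u
    at-zero = subst (λ d → T (d ∨ lookup N₁ u)) (dec-false (u ≟ v) u≢v)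
    at-v : Adj Gˢ (suc u) b → In₂ u
    at-v e rewrite dec-false (u ≟ v) u≢v | dec-true (v ≟ v) refl = e
    preserves : ∀ {y} → Adj Gˢ (suc u) y → Adj G u (ψ y)
    preserves {zero} e = subst T (adj-sym G v u) (In₁⇒adj (at-zero e))
    preserves {suc w} e with u ≟ v
    ... | yes u≡v = contradiction u≡v u≢v
    ... | no _ with w ≟ v
    ...   | yes refl = subst T (adj-sym G v u) (In₂⇒adj e)
    ...   | no _ = e
    inj : ∀ {y z} → Adj Gˢ (suc u) y → Adj Gˢ (suc u) z → ψ y ≡ ψ z → y ≡ z
    inj {zero}  {zero}  _ _ _ = refl
    inj {zero}  {suc z} e f refl = contradiction (at-v f) (In₁⇒¬In₂ (at-zero e))
    inj {suc y} {zero}  e f refl = contradiction (at-v e) (In₁⇒¬In₂ (at-zero f))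
    inj {suc y} {suc z} _ _ eq = cong suc eq

  other-degree≥ : ∀ {u} → u ≢ v → Δ ≤ degree Gˢ (suc u)
  other-degree≥ {u} u≢v = subst (_≤ _) (reg u) (card-mono (adj G u) (adj Gˢ (suc u))
      (λ w → ι w (w ≟ v) (T? (lookup N₁ u)))
      (λ {w} → preserves w (w ≟ v) (T? (lookup N₁ u))) (λ {w} {z} _ _ → inj w z (w ≟ v) (z ≟ v)
          (T? (lookup N₁ u))))
    where
    ι : ∀ w → Dec (w ≡ v) → Dec (In₁ u) → Fin (suc n)
    ι w (no _)  _       = suc w
    ι w (yes _) (yes _) = a
    ι w (yes _) (no _)  = b
    preserves : ∀ w d d′ → Adj G u w → Adj Gˢ (suc u) (ι w d d′)
    preserves w (no w≢v) _      e = other-adj u≢v w≢v e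
    preserves w (yes _) (yes p) e = reverse-adj {a} {suc u} (a-adj p)
    preserves w (yes refl) (no ¬p) e with adj⇒In (subst T (adj-sym G u w) e)
    ... | inj₁ p = contradiction p ¬p
    ... | inj₂ p = reverse-adj {b} {suc u} (b-adj p)
    inj : ∀ w z dw dz d → ι w dw d ≡ ι z dz d → w ≡ z
    inj w z (no _) (no _) _ refl = refl
    inj w z (no w≢v) (yes _) (no _) eq = contradiction (suc-injective eq) w≢v
    inj w z (no _) (yes _) (yes _) ()
    inj w z (yes _) (no z≢v) (no _) eq = contradiction (sym (suc-injective eq)) z≢v
    inj w z (yes _) (no _) (yes _) ()
    inj w z (yes refl) (yes refl) _ _ = refl

  -- Sending `b` to an element of `N₂` embeds the neighbours of `a` into those of `v`; for this `N₂`
  -- has to be nonempty.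
  a-degree≤ : degree Gˢ a ≤ Δ
  a-degree≤ = subst (_ ≤_) (reg v) (card-mono (adj Gˢ a) (adj G v) ψ (λ {y} → preserves y)
      (λ {y} {z} → inj y z))
    where
    z₂ = proj₁ some₂
    ψ : Fin (suc n) → Fin n
    -- A default value: `a` is not adjacent to itself.
    ψ zero    = v
    ψ (suc w) = if does (w ≟ v) then z₂ else w
    preserves : ∀ y → Adj Gˢ a y → Adj G v (ψ y)
    preserves (suc w) e with w ≟ v
    ... | yes _ = In₂⇒adj (proj₂ some₂)
    ... | no _ = In₁⇒adj e
    inj : ∀ y z → Adj Gˢ a y → Adj Gˢ a z → ψ y ≡ ψ z → y ≡ z
    inj (suc y) (suc z) e f eq with y ≟ v | z ≟ v
    ... | yes refl | yes refl = refl
    ... | yes _ | no _ = contradiction (subst In₂ eq (proj₂ some₂)) (In₁⇒¬In₂ f)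
    ... | no _ | yes _ = contradiction (subst In₂ (sym eq) (proj₂ some₂)) (In₁⇒¬In₂ e)
    ... | no _ | no _ = cong suc eq

  b-degree≤ : degree Gˢ b ≤ Δ
  b-degree≤ = subst (_ ≤_) (reg v) (card-mono (adj Gˢ b) (adj G v) ψ (λ {y} → preserves y)
      (λ {y} {z} → inj y z))
    where
    ψ : Fin (suc n) → Fin n
    ψ zero    = proj₁ some₁
    ψ (suc w) = w
    at : ∀ {w} → Adj Gˢ b (suc w) → In₂ w
    at {w} = subst (λ d → T (if d then lookup N₂ w else
        if does (w ≟ v) then lookup N₂ v else adj G v w)) (dec-true (v ≟ v) refl)
    preserves : ∀ y → Adj Gˢ b y → Adj G v (ψ y)
    preserves zero    _ = In₁⇒adj (proj₂ some₁)
    preserves (suc w) e = In₂⇒adj (at {w} e)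
    inj : ∀ y z → Adj Gˢ b y → Adj Gˢ b z → ψ y ≡ ψ z → y ≡ z
    inj zero    zero    _ _ _  = refl
    inj zero    (suc z) e f eq = contradiction (at {z} f) (In₁⇒¬In₂ (subst In₁ eq (proj₂ some₁)))
    inj (suc y) zero    e f eq = contradiction (at {y} e)
        (In₁⇒¬In₂ (subst In₁ (sym eq) (proj₂ some₁)))
    inj (suc y) (suc z) e f eq = cong suc eq

  degree≤ : ∀ x → degree Gˢ x ≤ Δ
  degree≤ zero = a-degree≤
  degree≤ (suc u) = cases (u ≟ v)
    where
    cases : Dec (u ≡ v) → degree Gˢ (suc u) ≤ Δ
    cases (yes refl) = b-degree≤
    cases (no u≢v)   = other-degree≤ u≢v

  full-vertex : ∃ λ x → Δ ≤ degree Gˢ x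
  full-vertex = suc (proj₁ some₁) , other-degree≥ (≢-sym (adj⇒≢ G (In₁⇒adj (proj₂ some₁))))

  someColour : Fin Δ
  someColour = EdgeColouring.colour φ v _ (In₁⇒adj (proj₂ some₁))

  neighbour : ∀ x → ∃ (Adj Gˢ x)
  neighbour zero = b , ab
  neighbour (suc u) = cases (u ≟ v)
    where
    cases : Dec (u ≡ v) → ∃ (Adj Gˢ (suc u))
    cases (yes refl) = a , reverse-adj {a} {b} ab
    cases (no u≢v)   = member (adj Gˢ (suc u)) i , member∈ (adj Gˢ (suc u)) i
      -- That a colour exists shows that `Δ`, and hence this degree, is positive.
      where i = inject≤ someColour (other-degree≥ u≢v)

  -- All vertices but `a` and `b` have degree at least `j` and see every colour, while `a` and `b`
  -- see that of their common edge, which is thus a perfect matching.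
  overfull : ∀ {j} → j ≤ Δ → ¬ EdgeColouring Gˢ j
  overfull {j} j≤Δ ψ = no-consecutive-perfect-matchings
      (P.partner-involutive someColour) (P.partner-≢ someColour) Q.partner-involutive Q.partner-≢
    where
    c : Fin j
    c = EdgeColouring.colour ψ a b ab
    sat′ : ∀ x → ∃ (HasColour ψ c x)
    sat′ zero = b , ab , refl
    sat′ (suc u) = cases (u ≟ v)
      where
      cases : Dec (u ≡ v) → ∃ (HasColour ψ c (suc u))
      cases (yes refl) = a , hasColour-sym ψ (ab , refl)
      cases (no u≢v)   = saturated ψ (≤-trans j≤Δ (other-degree≥ u≢v)) c
    module Q = Partner ψ sat′

  module _ (bound : 2 * (n ∸ 1) ≤ 3 * Δ) where

    deletable′ : ∀ {x y} → Edgeˢ x y → Colouring Gˢ Δ [ (x , y) ]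
    deletable′ a–b = record { M = M ; inv = inv ; covers = NearFactor.covers nearFactor }
    deletable′ (a–N₁ {w} p) = incident Gˢ nearFactor (a-adj p)
        (≢b λ { refl → adj⇒≢ G (In₁⇒adj p) refl }) a≢b
    deletable′ (b–N₂ {w} p) = incident Gˢ (reverse Gˢ nearFactor) (b-adj p) (≢-sym 0≢1+n)
        (≢-sym a≢b)
    deletable′ (other {u} {w} u≢v w≢v e) with T? (adj G v u) | T? (adj G v w)
    ... | yes vu | _ = near Gˢ nearFactor a≢b free-at-a free-at-b (other-adj u≢v w≢v e) (λ ())
        (≢b u≢v) (λ ()) (≢b w≢v)
                         (Sum.map a-adj b-adj (adj⇒In vu))
    ... | no _ | yes vw = Colouring-sym Gˢ (near Gˢ nearFactor a≢b free-at-a free-at-b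
        (reverse-adj {suc u} {suc w} (other-adj u≢v w≢v e))
                         (λ ()) (≢b w≢v) (λ ()) (≢b u≢v) (Sum.map a-adj b-adj (adj⇒In vw)))
    -- A common neighbour of `v`, `u` and `w` is adjacent to `a` or to `b` after the splitting.
    ... | no ¬vu | no ¬vw with commonNeighbour G reg bound ¬vu ¬vw (≢-sym u≢v) (≢-sym w≢v) e
    ...   | t , vt , ut , wt = far Gˢ nearFactor a≢b free-at-a free-at-b (other-adj u≢v w≢v e)
        (λ ()) (≢b u≢v) (λ ()) (≢b w≢v)
              {suc t} (λ ()) (≢b t≢v) (other-adj t≢v u≢v (subst T (adj-sym G u t) ut))
                  (other-adj t≢v w≢v (subst T (adj-sym G w t) wt))
              (Sum.map a-adj b-adj (adj⇒In vt))
      where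
      t≢v : t ≢ v
      t≢v = ≢-sym (adj⇒≢ G vt)

    deletable : ∀ x y → Adj Gˢ x y → Colouring Gˢ Δ [ (x , y) ]
    deletable x y e = Sum.[ deletable′ , Colouring-sym Gˢ ∘ deletable′ ] (view x y e)

-- Edge colourings of embedded graphs from families of matchings.

module _ {h m k} (H : Graph h) {ι : Fin h → Fin m} (ι-injective : Injective _≡_ _≡_ ι)
         {M : Family k m} (inv : ∀ c → Involutive (M c))
         (coloured : ∀ u v → Adj H u v → ∃ λ c → M c (ι u) ≡ ι v) where

  -- An edge may have several colours: the one found from its smaller end is taken.
  private
    select : ∀ u v → Tri (u <ᶠ v) (u ≡ v) (v <ᶠ u) → Adj H u v → Fin k
    select u v (tri< _ _ _) e = proj₁ (coloured u v e)
    select u v (tri≈ _ u≡v _) e = contradiction u≡v (adj⇒≢ H e)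
    select u v (tri> _ _ _) e = proj₁ (coloured v u (subst T (adj-sym H u v) e))

    select-correct : ∀ u v t e → M (select u v t e) (ι u) ≡ ι v
    select-correct u v (tri< _ _ _) e = proj₂ (coloured u v e)
    select-correct u v (tri≈ _ u≡v _) e = contradiction u≡v (adj⇒≢ H e)
    select-correct u v (tri> _ _ _) e with coloured v u (subst T (adj-sym H u v) e)
    ... | c , eq = trans (cong (M c) (sym eq)) (inv c (ι v))

    select-sym : ∀ u v t t′ e e′ → select u v t e ≡ select v u t′ e′
    select-sym u v (tri< _ _ _)   (tri> _ _ _)   e e′ = cong (proj₁ ∘ coloured u v)
        (T-irrelevant _ _)
    select-sym u v (tri> _ _ _)   (tri< _ _ _)   e e′ = cong (proj₁ ∘ coloured v u)
        (T-irrelevant _ _)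
    select-sym u v (tri≈ _ u≡v _) _              e e′ = contradiction u≡v (adj⇒≢ H e)
    select-sym u v _              (tri≈ _ v≡u _) e e′ = contradiction v≡u (adj⇒≢ H e′)
    select-sym u v (tri< _ _ v≮u) (tri< v<u _ _) e e′ = contradiction v<u v≮u
    select-sym u v (tri> _ _ v<u) (tri> v≮u _ _) e e′ = contradiction v<u v≮u

  edgeColouring : EdgeColouring H k
  edgeColouring = record
    { colour     = λ u v → select u v (<-cmp u v)
    ; colour-sym = λ u v → select-sym u v (<-cmp u v) (<-cmp v u)
    -- An involution sends `ι u` to one vertex only, so two edges at `u` of the same colour
    -- coincide.
    ; proper     = λ u v w e e′ v≢w eq → v≢w (ι-injective (begin
        ι v                                     ≡⟨ select-correct u v (<-cmp u v) e ⟨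
        M (select u v (<-cmp u v) e) (ι u)      ≡⟨ cong (λ c → M c (ι u)) eq ⟩
        M (select u w (<-cmp u w) e′) (ι u)     ≡⟨ select-correct u w (<-cmp u w) e′ ⟩
        ι w ∎))
    }
    where open ≡-Reasoning

-- Maximum degree, chromatic index and criticality.

maxDegree-≡ : ∀ {n d} (G : Graph n) → (∀ u → degree G u ≤ d) → (∃ λ u → d ≤ degree G u) →
    maxDegree G ≡ d
maxDegree-≡ {n} G ≤d (u , d≤) = ≤-antisym
  (max≤v⁺ z≤n (All-map⁺ (universal ≤d (allFin n))))
  (v≤max⁺ 0 _ (inj₂ (Any-map⁺ (lose (∈-allFin u) d≤))))

theorem1p2 : ∀ (n Δ : ℕ) (G* : Graph n) → Connected G* → Class1 G* → Regular Δ G* →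
    2 * (n ∸ 1) ≤ 3 * Δ →
    ∀ {m} (G : Graph m) → G ObtainedBySplitting G* → Critical Δ G
theorem1p2 n Δ G* _ class1 reg bound {m} G (S , iso) = max≡Δ , trans χ≡ (cong suc (sym max≡Δ)) ,
    smaller
  where
  open _≅_ iso
  open Inverse vertices using (to; from; strictlyInverseˡ; strictlyInverseʳ)

  φ : EdgeColouring G* Δ
  φ = subst (EdgeColouring G*)
    -- The vertex that is split shows that the maximum `Δ` is attained.
    (trans class1 (maxDegree-≡ G* (≤-reflexive ∘ reg) (Splitting.v S , ≤-reflexive (sym (reg _)))))
    (proj₁ (χ′-correct G*))

  open Split G* φ reg S

  to-injective : Injective _≡_ _≡_ to
  to-injective {x} {y} eq = trans (sym (strictlyInverseʳ x))
      (trans (cong from eq) (strictlyInverseʳ y))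

  from-injective : Injective _≡_ _≡_ from
  from-injective {x} {y} eq = trans (sym (strictlyInverseˡ x))
      (trans (cong to eq) (strictlyInverseˡ y))

  adj-to : ∀ {u w} → Adj G u w → Adj Gˢ (to u) (to w)
  adj-to {u} {w} = subst T (adj-≡ u w)

  adj-from : ∀ {x y} → Adj Gˢ x y → Adj G (from x) (from y)
  adj-from {x} {y} e = subst T (sym (adj-≡ (from x) (from y)))
    (subst₂ (Adj Gˢ) (sym (strictlyInverseˡ x)) (sym (strictlyInverseˡ y)) e)

  degree-to : ∀ u → degree G u ≤ degree Gˢ (to u)
  degree-to u = card-mono (adj G u) (adj Gˢ (to u)) to adj-to (λ _ _ → to-injective)

  degree-from : ∀ x → degree Gˢ x ≤ degree G (from x)
  degree-from x = card-mono (adj Gˢ x) (adj G (from x)) from (λ {y} → adj-from {x} {y}) (λ _ _ →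
      from-injective)

  max≡Δ : maxDegree G ≡ Δ
  max≡Δ = maxDegree-≡ G (λ u → ≤-trans (degree-to u) (degree≤ (to u)))
    (from (proj₁ full-vertex) , ≤-trans (proj₂ full-vertex) (degree-from _))

  class2 : ∀ {j} → EdgeColouring G j → ¬ j ≤ Δ
  class2 ψ j≤Δ = overfull j≤Δ record
    { colour     = λ x y e → EdgeColouring.colour ψ (from x) (from y) (adj-from {x} {y} e)
    ; colour-sym = λ x y e e′ → colour-sym ψ (from x) (from y) _ _
    ; proper     = λ x y z e e′ y≢z → proper ψ (from x) (from y) (from z) _ _ (y≢z ∘ from-injective)
    }

  -- The additional colour `zero` is used for the edge from `a` to `b` alone.
  M⁺ : Family (suc Δ) (suc n)
  M⁺ zero    = transpose a b
  M⁺ (suc c) = M c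

  colouring⁺ : EdgeColouring G (suc Δ)
  colouring⁺ = edgeColouring G to-injective {M = M⁺}
      (λ { zero → transpose-involutive a b ; (suc c) → inv c })
    λ u w e → cover (NearFactor.covers nearFactor (to u) (to w) (adj-to e))
    where
    cover : ∀ {x y} → (∃ λ c → M c x ≡ y) ⊎ Any (Same Gˢ (x , y)) [ (a , b) ] → ∃ λ c → M⁺ c x ≡ y
    cover (inj₁ (c , eq))                   = suc c , eq
    cover (inj₂ (here (inj₁ (refl , refl)))) = zero , transpose-matchˡ a b
    cover (inj₂ (here (inj₂ (refl , refl)))) = zero , transpose-matchʳ a b

  χ≡ : χ′ G ≡ suc Δ
  χ≡ = ≤-antisym (proj₂ (χ′-correct G) (suc Δ) colouring⁺) (≰⇒> (class2 (proj₁ (χ′-correct G))))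

  smaller : ∀ {h} (H : Graph h) → ProperSubgraph H G → χ′ H < χ′ G
  smaller H sub = subst (χ′ H <_) (sym χ≡)
      (s≤s (proj₂ (χ′-correct H) Δ (colour-H (missing strict))))
    where
    open ProperSubgraph sub
    ι = to ∘ embed

    Missing : Set
    Missing = ∃₂ λ x y → Adj Gˢ x y × (∀ u w → Adj H u w → ¬ Same Gˢ (ι u , ι w) (x , y))

    ι-injective : Injective _≡_ _≡_ ι
    ι-injective = injective ∘ to-injective

    missing : _ → Missing
    -- No vertex of the split graph is isolated, so a subgraph that misses a vertex also misses an
    -- edge.
    missing (inj₁ (z , z∉)) with neighbour (to z)
    ... | y , e = to z , y , e , λ where
      u w _ (inj₁ (eq , _)) → z∉ u (to-injective eq)
      u w _ (inj₂ (_ , eq)) → z∉ w (to-injective eq)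
    missing (inj₂ (u , w , e , ¬uw)) = ι u , ι w , adj-to e , λ where
      u′ w′ f (inj₁ (p , q)) → ¬uw (subst₂ (Adj H) (ι-injective p) (ι-injective q) f)
      u′ w′ f (inj₂ (p , q)) →
          ¬uw (subst T (adj-sym H w u) (subst₂ (Adj H) (ι-injective p) (ι-injective q) f))

    colour-H : Missing → EdgeColouring H Δ
    colour-H (x , y , e , avoid) = edgeColouring H ι-injective {M = C.M} C.inv λ u w f →
        cover u w f (C.covers (ι u) (ι w) (adj-to (edges u w f)))
      where
      module C = Colouring (deletable bound x y e)
      cover : ∀ u w → Adj H u w →
              (∃ λ c → C.M c (ι u) ≡ ι w) ⊎ Any (Same Gˢ (ι u , ι w)) [ (x , y) ] →
              ∃ λ c → C.M c (ι u) ≡ ι w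
      cover u w f (inj₁ r)        = r
      cover u w f (inj₂ (here s)) = contradiction s (avoid u w f)
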